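{- Let $G=(V,E)$ be a connected Eulerian directed graph (i.e. $\deg^+(v)=\deg^-(v)$ for all $v\in V$; loops and multiple edges allowed) and let $s\in V$. Then the Biggs-Merino polynomial $B(G,s;y)$ equals the greedoid Tutte polynomial $T(G,s;y)$.
   Context: $\deg^+(v)$ is the outdegree of $v$. Sandpile model with sink $s$: an $s$-configuration is $\hat{\mathbf c}\in\mathbb N_0^{V\setminus\{s\}}$. Firing a vertex $v\neq s$ removes $\deg^+(v)$ chips from $v$ and sends one chip along each outgoing edge of $v$ to its target (a loop returns its chip to $v$); chips sent to $s$ disappear. The firing is legal if $\hat{\mathbf c}(v)\ge \deg^+(v)$. $\hat{\mathbf c}$ is stable if $\hat{\mathbf c}(v)<\deg^+(v)$ for all $v\ne s$. Every $s$-configuration $\hat{\mathbf c}$ reaches, by a finite sequence of legal firings, a unique stable $s$-configuration $\hat{\mathbf c}^\circ$. An $s$-configuration $\hat{\mathbf c}$ is $s$-recurrent if for every $s$-configuration $\hat{\mathbf c}_1$ there is an $s$-configuration $\hat{\mathbf c}_2$ with $(\hat{\mathbf c}_1+\hat{\mathbf c}_2)^\circ=\hat{\mathbf c}$; $\mathrm{Rec}(G,s)$ is the set of these. Let $\mathbf u_s\in\mathbb N_0^{V\setminus\{s\}}$ with $\mathbf u_s(v)$ the number of edges from $s$ to $v$. On $\mathrm{Rec}(G,s)$ define $\hat{\mathbf c}\overset{s}{\sim}\hat{\mathbf d}$ iff $\hat{\mathbf d}=(\hat{\mathbf c}+k\mathbf u_s)^\circ$ for some $k\in\mathbb N_0$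 (an equivalence relation); $\mathrm{Rec}(G,\overset{s}{\sim})$ is the set of classes. The d-level of $\hat{\mathbf c}$ is $\mathrm{dlvl}(\hat{\mathbf c})=\deg^+(s)+\sum_{v\neq s}\hat{\mathbf c}(v)$, the d-level of a class is the maximum d-level of its elements, and $B(G,s;y)=\sum_{[\hat{\mathbf c}]\in \mathrm{Rec}(G,\overset{s}{\sim})}y^{\mathrm{dlvl}([\hat{\mathbf c}])}$. Greedoid Tutte polynomial: fix a total order $<$ on $E$. A directed path of length $k\ge 0$ is $v_0e_0v_1\dots e_{k-1}v_k$ with pairwise distinct vertices and $e_i$ an edge from $v_i$ to $v_{i+1}$. An arborescence rooted at $s$ is a subgraph $T$ with vertex set $V$ such that for every $v\in V$ there is a unique directed path in $T$ from $s$ to $v$; $A(G,s)$ denotes the set of these. For an edge $e\notin E(T)$ there are exactly two edge-disjoint directed paths $P_1,P_2$ in $(V,E(T)\cup\{e\})$ having the same starting vertex and both ending at the target of $e$, with $P_1$ the one containing $e$; $e$ is externally active in $T$ if the $<$-smallest edge of $E(P_1)\cup E(P_2)$ lies in $P_1$. $e(T)$ is the number of externally active edges of $T$, and $T(G,s;y)=\sum_{T\in A(G,s)}y^{e(T)}$ (this does not depend on the chosen order).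
   Formalization: Arborescences are also required to have every edge on a directed path from s (excluding loops and edges into s), and the paths P1, P2 defining external activity may be closed, since no such pair exists when e closes a directed cycle. -}

module Defs where

open import Data.Nat using (ℕ; zero; suc; _+_; _*_; _∸_; _≤_; _<_)
open import Data.Fin using (Fin) renaming (_≤_ to _≤ᶠ_)
open import Data.Fin.Properties using (_≟_)
open import Data.Fin.Subset using (Subset; _∈_; _∉_)
open import Data.Vec using (Vec; lookup; tabulate; zipWith)
open import Data.List using (List; []; _∷_; _++_; [_]; length; filter; allFin; map)
open import Data.Nat.ListAction using (sum)
open import Data.List.Membership.Propositional using () renaming (_∈_ to _∈ₗ_)
open import Data.List.Relation.Unary.All using (All)
open import Data.List.Relation.Unary.Unique.Propositional using (Unique)
open import Data.Product using (Σ; ∃; _×_; _,_)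
open import Data.Sum using (_⊎_)
open import Data.Bool using (if_then_else_)
open import Relation.Nullary using (¬_; ⌊_⌋)
open import Relation.Nullary.Decidable using (_×-dec_)
open import Relation.Binary.PropositionalEquality using (_≡_; _≢_)
open import Relation.Binary.Construct.Closure.ReflexiveTransitive using (Star)

HasSizeMod : {A : Set} → (A → A → Set) → (A → Set) → ℕ → Set
HasSizeMod {A} _≈_ P N =
  Σ (Fin N → A) λ f →
    (∀ i → P (f i)) ×
    (∀ i j → f i ≈ f j → i ≡ j) ×
    (∀ a → P a → ∃ λ i → f i ≈ a)

HasSize : {A : Set} → (A → Set) → ℕ → Set
HasSize = HasSizeMod _≡_

record Digraph : Set where
  field
    n    : ℕ
    m    : ℕ
    src  : Fin m → Fin n
    tgt  : Fin m → Fin n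

module _ (G : Digraph) where
  open Digraph G

  outdeg : Fin n → ℕ
  outdeg v = length (filter (λ e → src e ≟ v) (allFin m))

  indeg : Fin n → ℕ
  indeg v = length (filter (λ e → tgt e ≟ v) (allFin m))

  mult : Fin n → Fin n → ℕ
  mult u w = length (filter (λ e → (src e ≟ u) ×-dec (tgt e ≟ w)) (allFin m))

  Eulerian : Set
  Eulerian = ∀ v → outdeg v ≡ indeg v

  UAdj : Fin n → Fin n → Set
  UAdj x y = ∃ λ e → (src e ≡ x × tgt e ≡ y) ⊎ (src e ≡ y × tgt e ≡ x)

  Connected : Set
  Connected = ∀ u v → Star UAdj u v

  verts : Fin n → List (Fin m) → List (Fin n)
  verts u []       = u ∷ []
  verts u (e ∷ es) = u ∷ verts (tgt e) es

  data IsWalk : Fin n → List (Fin m) → Fin n → Set where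
    nil  : ∀ {u} → IsWalk u [] u
    cons : ∀ {u e es v} → src e ≡ u → IsWalk (tgt e) es v → IsWalk u (e ∷ es) v

  IsPath : (Fin m → Set) → Fin n → List (Fin m) → Fin n → Set
  IsPath H u es v = IsWalk u es v × All H es × Unique (verts u es)

  tailV : Fin n → List (Fin m) → List (Fin n)
  tailV u []       = []
  tailV u (e ∷ es) = verts (tgt e) es

  IsPath⁰ : (Fin m → Set) → Fin n → List (Fin m) → Fin n → Set
  IsPath⁰ H u es v =
    IsWalk u es v × All H es × (Unique (verts u es) ⊎ (u ≡ v × Unique (tailV u es)))

  -- Arborescences and external activity (edge order = order of Fin m)

  InT : Subset m → Fin m → Set
  InT S e = e ∈ S

  module _ (s : Fin n) where

    Arborescence : Subset m → Set
    Arborescence S =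
      (∀ v → ∃ λ es → IsPath (InT S) s es v) ×
      (∀ v es es' → IsPath (InT S) s es v → IsPath (InT S) s es' v → es ≡ es') ×
      (∀ e → e ∈ S → ∃ λ es → IsPath (InT S) s (es ++ [ e ]) (tgt e))

  InT+ : Subset m → Fin m → Fin m → Set
  InT+ S e f = f ∈ S ⊎ f ≡ e

  ExternallyActive : Subset m → Fin m → Set
  ExternallyActive S e =
    e ∉ S ×
    ∃ λ u → Σ (List (Fin m)) λ P₁ → Σ (List (Fin m)) λ P₂ →
      IsPath⁰ (InT+ S e) u P₁ (tgt e) ×
      IsPath⁰ (InT+ S e) u P₂ (tgt e) ×
      (∀ f → f ∈ₗ P₁ → ¬ (f ∈ₗ P₂)) ×
      e ∈ₗ P₁ ×
      (∃ λ f → f ∈ₗ P₁ × (∀ g → g ∈ₗ (P₁ ++ P₂) → f ≤ᶠ g))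

  ExtActivity : Subset m → ℕ → Set
  ExtActivity S k = HasSize (ExternallyActive S) k

  -- coefficient of y^k in T(G,s;y) is N
  TCoeff : Fin n → ℕ → ℕ → Set
  TCoeff s k N = HasSize (λ S → Arborescence s S × ExtActivity S k) N

  Config : Set
  Config = Vec ℕ n

  module _ (s : Fin n) where

    SConfig : Config → Set
    SConfig c = lookup c s ≡ 0

    -- firing v (chips sent to s disappear)
    fire : Config → Fin n → Config
    fire c v = tabulate λ w →
      if ⌊ w ≟ s ⌋ then 0
      else (lookup c w ∸ (if ⌊ w ≟ v ⌋ then outdeg v else 0)) + mult v w

    LegalFiring : Config → Config → Set
    LegalFiring c d = ∃ λ v → v ≢ s × outdeg v ≤ lookup c v × d ≡ fire c v

    Stable : Config → Set
    Stable c = ∀ v → v ≢ s → lookup c v < outdeg v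

    Stabilizes : Config → Config → Set
    Stabilizes c d = Star LegalFiring c d × Stable d

    _⊕_ : Config → Config → Config
    _⊕_ = zipWith _+_

    Recurrent : Config → Set
    Recurrent c =
      SConfig c ×
      (∀ c₁ → SConfig c₁ → ∃ λ c₂ → SConfig c₂ × Stabilizes (c₁ ⊕ c₂) c)

    uₛ : Config
    uₛ = tabulate λ v → if ⌊ v ≟ s ⌋ then 0 else mult s v

    scale : ℕ → Config → Config
    scale k c = tabulate λ v → k * lookup c v

    _∼_ : Config → Config → Set
    c ∼ d = ∃ λ k → Stabilizes (c ⊕ scale k uₛ) d

    dlvl : Config → ℕ
    dlvl c = outdeg s + sum (map (λ v → if ⌊ v ≟ s ⌋ then 0 else lookup c v) (allFin n))

    ClassLevel : Config → ℕ → Set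
    ClassLevel c ℓ =
      (∃ λ d → Recurrent d × c ∼ d × dlvl d ≡ ℓ) ×
      (∀ d → Recurrent d → c ∼ d → dlvl d ≤ ℓ)

    -- coefficient of y^ℓ in B(G,s;y) is N: number of classes of level ℓ
    BCoeff : ℕ → ℕ → Set
    BCoeff ℓ N = HasSizeMod _∼_ (λ c → Recurrent c × ClassLevel c ℓ) N

{-# OPTIONS --safe #-}

-- For an Eulerian digraph, adding uₛ to a recurrent configuration and stabilising
-- fires every non-sink vertex exactly once and gives the configuration back, so
-- each ∼-class is a single configuration. Recurrent configurations correspond to
-- arborescences by a burning process on edges (Cori–Le Borgne): starting with s
-- burnt, repeatedly process the largest unprocessed edge whose source is burnt. For
-- a configuration c, the vertex v catches fire once c(v) plus the number of processed
-- edges into v reaches deg⁻(v); for an arborescence, once its tree edge has been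
-- processed. The igniting edges form the arborescence, and c(v) is the number of edges
-- into v processed after v was burnt. The d-level is therefore the number of edges
-- processed after their target was burnt, and these are the externally active ones:
-- of the two paths closed by e, the one containing their smallest edge finishes last.
module Submission where

open import Defs
open import Data.Bool using (true; false; if_then_else_)
open import Data.Fin using (Fin; zero; suc) renaming (_≤_ to _≤ᶠ_)
open import Data.Fin.Properties using (_≟_; injective⇒≤; any?; all?) renaming (≤-antisym to ≤ᶠ-antisym; _≤?_ to _≤ᶠ?_)
open import Data.Fin.Subset using (Subset; inside; outside) renaming (_∈_ to _∈ˢ_; _∉_ to _∉ˢ_)
open import Data.Fin.Subset.Properties using (⊆-antisym) renaming (_∈?_ to _∈ˢ?_)
open import Data.List using (List; []; _∷_; _++_; length; filter; allFin; map) renaming (lookup to lookupₗ)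
open import Data.List.Membership.DecPropositional using () renaming (_∈?_ to mem?)
open import Data.List.Membership.Propositional using (_∈_; _∉_)
open import Data.List.Membership.Propositional.Properties using (∈-lookup; ∈-filter⁺; ∈-filter⁻; ∈-allFin; ∈-++⁺ˡ; ∈-++⁺ʳ; ∈-++⁻; ∈-map⁺; ∈-map⁻; ∈-∃++)
open import Data.List.Properties using (length-tabulate; map-++; ∷ʳ-injectiveˡ; ∷ʳ-injectiveʳ; ++-cancelˡ)
open import Data.List.Relation.Unary.All using (All; []; _∷_) renaming (lookup to All-lookup; tabulate to All-tabulate; map to All-map)
open import Data.List.Relation.Unary.All.Properties using () renaming (++⁺ to All-++⁺; ++⁻ˡ to All-++⁻ˡ; ++⁻ʳ to All-++⁻ʳ)
open import Data.List.Relation.Unary.AllPairs using ([]; _∷_)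
open import Data.List.Relation.Unary.Any using (here; there; index)
open import Data.List.Relation.Unary.Any.Properties using (lookup-index)
open import Data.List.Relation.Unary.Unique.Propositional using (Unique)
open import Data.List.Relation.Unary.Unique.Propositional.Properties using (allFin⁺; Unique[x∷xs]⇒x∉xs) renaming (map⁺ to Unique-map⁺; ++⁺ to Unique-++⁺; filter⁺ to Unique-filter⁺)
open import Data.List.Reverse using (Reverse; reverseView; []; _∶_∶ʳ_)
open import Data.Nat using (ℕ; zero; suc; _+_; _*_; _∸_; _≤_; _<_; z≤n; s≤s)
open import Data.Nat.ListAction using (sum)
open import Data.Nat.Properties renaming (_≟_ to _≟ⁿ_)
open import Data.Product using (∃; _×_; _,_; proj₁; proj₂)
open import Data.Sum using (_⊎_; inj₁; inj₂; [_,_]′)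
open import Data.Unit using (⊤; tt)
open import Data.Vec using (Vec; lookup; tabulate) renaming ([] to []ᵛ; _∷_ to _∷ᵛ_)
open import Data.Vec.Properties using (lookup∘tabulate; tabulate∘lookup; tabulate-cong; lookup-zipWith; ∷-injectiveʳ; lookup⇒[]=; []=⇒lookup)
open import Relation.Binary.Construct.Closure.ReflexiveTransitive using (Star; ε; _◅_; _◅◅_)
open import Relation.Binary.PropositionalEquality
open import Relation.Nullary using (¬_; Dec; yes; no; ⌊_⌋; does; contradiction)
open import Relation.Nullary.Decidable using (_×-dec_; _⊎-dec_; _→-dec_; ¬?; map′; dec-true; decidable-stable)
open import Relation.Unary using (Decidable)

-- Recurrence is defined by reachability, so the burning test has to be derived from it in both
-- directions. From recurrence: having no forbidden set survives legal firings, and it holds as soon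
-- as every non-sink vertex carries its outdegree in chips. To recurrence: a stable configuration
-- `c` with a full burning order absorbs `uₛ`, and from `uₛ` one builds absorbed configurations that
-- dominate any given `c₁`. The burning of a configuration and that of an arborescence are instances
-- of one abstract `Rule`. To see that the two translations are mutually inverse, it is enough that
-- two rules burn the same vertices at every stage of a single run: that run then belongs to both,
-- with the same late edges and the same igniting edges.

-- Finite enumerations and sizes.

lookup-injective : {A : Set} {xs : List A} → Unique xs →
  ∀ i j → lookupₗ xs i ≡ lookupₗ xs j → i ≡ j
lookup-injective (_ ∷ _) zero zero _ = refl
lookup-injective (x∉ ∷ _) zero (suc j) eq = contradiction eq (All-lookup x∉ (∈-lookup j))
lookup-injective (x∉ ∷ _) (suc i) zero eq = contradiction (sym eq) (All-lookup x∉ (∈-lookup i))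
lookup-injective (_ ∷ u) (suc i) (suc j) eq = cong suc (lookup-injective u i j eq)

unique-⊆⇒length-≤ : {A : Set} {xs ys : List A} → Unique xs →
  (∀ {x} → x ∈ xs → x ∈ ys) → length xs ≤ length ys
unique-⊆⇒length-≤ {xs = xs} {ys} u sub = injective⇒≤ {f = f} λ {i} {j} eq →
  lookup-injective u i j (trans (at i) (trans (cong (lookupₗ ys) eq) (sym (at j))))
  where
  f : Fin (length xs) → Fin (length ys)
  f i = index (sub (∈-lookup {xs = xs} i))
  at : ∀ i → lookupₗ xs i ≡ lookupₗ ys (f i)
  at i = lookup-index (sub (∈-lookup {xs = xs} i))

list⇒HasSize : {A : Set} {P : A → Set} {xs : List A} → Unique xs →
  (∀ {x} → x ∈ xs → P x) → (∀ {x} → P x → x ∈ xs) → HasSize P (length xs)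
list⇒HasSize {xs = xs} u sound complete =
  lookupₗ xs , (λ i → sound (∈-lookup i)) , lookup-injective u ,
  λ a p → index (complete p) , sym (lookup-index (complete p))

HasSize-≤ : {A : Set} {P : A → Set} {j k : ℕ} → HasSize P j → HasSize P k → j ≤ k
HasSize-≤ (f , fP , f-inj , _) (g , _ , _ , g-sur) = injective⇒≤ {f = h} λ {x} {y} eq →
  f-inj x y (trans (sym (at x)) (trans (cong g eq) (at y)))
  where
  h = λ i → proj₁ (g-sur (f i) (fP i))
  at = λ i → proj₂ (g-sur (f i) (fP i))

-- External activity enters the statement only as a relation between a subset and a number; this
-- makes the number well defined.
HasSize-unique : {A : Set} {P : A → Set} {j k : ℕ} → HasSize P j → HasSize P k → j ≡ k
HasSize-unique p q = ≤-antisym (HasSize-≤ p q) (HasSize-≤ q p)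

subsets : ∀ k → List (Subset k)
subsets zero    = []ᵛ ∷ []
subsets (suc k) = map (inside ∷ᵛ_) (subsets k) ++ map (outside ∷ᵛ_) (subsets k)

∈-subsets : ∀ {k} (S : Subset k) → S ∈ subsets k
∈-subsets []ᵛ           = here refl
∈-subsets (true ∷ᵛ S)  = ∈-++⁺ˡ (∈-map⁺ _ (∈-subsets S))
∈-subsets (false ∷ᵛ S) = ∈-++⁺ʳ _ (∈-map⁺ _ (∈-subsets S))

subsets-unique : ∀ k → Unique (subsets k)
subsets-unique zero    = [] ∷ []
subsets-unique (suc k) = Unique-++⁺
  (Unique-map⁺ ∷-injectiveʳ (subsets-unique k)) (Unique-map⁺ ∷-injectiveʳ (subsets-unique k))
  λ (p , q) → disjoint (∈-map⁻ _ p) (∈-map⁻ _ q)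
  where
  disjoint : ∀ {S : Subset (suc k)} → (∃ λ U → U ∈ subsets k × S ≡ inside ∷ᵛ U) →
    ¬ (∃ λ U → U ∈ subsets k × S ≡ outside ∷ᵛ U)
  disjoint (_ , _ , refl) (_ , _ , ())

lookup-ext : ∀ {k} {A : Set} {xs ys : Vec A k} → (∀ i → lookup xs i ≡ lookup ys i) → xs ≡ ys
lookup-ext {xs = xs} {ys} eq =
  trans (sym (tabulate∘lookup xs)) (trans (tabulate-cong eq) (tabulate∘lookup ys))

if-yes : {A P : Set} {x y : A} (d : Dec P) → P → (if ⌊ d ⌋ then x else y) ≡ x
if-yes (yes _) p = refl
if-yes (no ¬p) p = contradiction p ¬p

if-no : {A P : Set} {x y : A} (d : Dec P) → ¬ P → (if ⌊ d ⌋ then x else y) ≡ y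
if-no (yes p) ¬p = contradiction p ¬p
if-no (no _) ¬p  = refl

greatest : ∀ {k} {P : Fin k → Set} → Decidable P →
  (∃ λ i → P i × (∀ {j} → P j → j ≤ᶠ i)) ⊎ (∀ i → ¬ P i)
greatest {zero} P? = inj₂ λ ()
greatest {suc k} {P} P? with greatest (λ i → P? (suc i))
... | inj₁ (i , p , max) = inj₁ (suc i , p , λ { {zero} _ → z≤n ; {suc j} q → s≤s (max q) })
... | inj₂ none with P? zero
...   | yes p = inj₁ (zero , p , λ { {zero} _ → z≤n ; {suc j} q → contradiction q (none j) })
...   | no ¬p = inj₂ λ { zero → ¬p ; (suc j) → none j }

least : ∀ {k} {x : Fin k} {xs : List (Fin k)} → x ∈ xs → ∃ λ f → f ∈ xs × (∀ g → g ∈ xs → f ≤ᶠ g)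
least {xs = y ∷ []} _ = y , here refl , λ { g (here refl) → ≤-refl }
least {xs = y ∷ z ∷ zs} _ with least {xs = z ∷ zs} (here refl)
... | f , f∈ , min with y ≤ᶠ? f
...   | yes y≤f = y , here refl , λ { g (here refl) → ≤-refl ; g (there p) → ≤-trans y≤f (min g p) }
...   | no y≰f  = f , there f∈ , λ { g (here refl) → ≰⇒≥ y≰f ; g (there p) → min g p }

-- Counting in lists.

count : {A : Set} {P : A → Set} → Decidable P → List A → ℕ
count P? xs = length (filter P? xs)

module _ {A : Set} where

  count-⊎ : {P Q R : A → Set} (P? : Decidable P) (Q? : Decidable Q) (R? : Decidable R) →
    (∀ {x} → P x → Q x ⊎ R x) → (∀ {x} → Q x → P x) → (∀ {x} → R x → P x) →
    (∀ {x} → Q x → ¬ R x) → ∀ xs → count P? xs ≡ count Q? xs + count R? xs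
  count-⊎ P? Q? R? split q⇒p r⇒p disj [] = refl
  count-⊎ P? Q? R? split q⇒p r⇒p disj (x ∷ xs)
    with P? x | Q? x | R? x | count-⊎ P? Q? R? split q⇒p r⇒p disj xs
  ... | yes p | yes q | yes r | _  = contradiction r (disj q)
  ... | yes p | yes q | no ¬r | ih = cong suc ih
  ... | yes p | no ¬q | yes r | ih = trans (cong suc ih) (sym (+-suc _ _))
  ... | yes p | no ¬q | no ¬r | _  = [ (λ q → contradiction q ¬q) , (λ r → contradiction r ¬r) ]′ (split p)
  ... | no ¬p | yes q | _     | _  = contradiction (q⇒p q) ¬p
  ... | no ¬p | no ¬q | yes r | _  = contradiction (r⇒p r) ¬p
  ... | no ¬p | no ¬q | no ¬r | ih = ih

  count-mono : {P Q : A → Set} (P? : Decidable P) (Q? : Decidable Q) →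
    (∀ {x} → P x → Q x) → ∀ xs → count P? xs ≤ count Q? xs
  count-mono P? Q? sub [] = z≤n
  count-mono P? Q? sub (x ∷ xs) with P? x | Q? x | count-mono P? Q? sub xs
  ... | yes p | yes q | ih = s≤s ih
  ... | yes p | no ¬q | _  = contradiction (sub p) ¬q
  ... | no ¬p | yes q | ih = m≤n⇒m≤1+n ih
  ... | no ¬p | no ¬q | ih = ih

  count-cong : {P Q : A → Set} (P? : Decidable P) (Q? : Decidable Q) →
    (∀ {x} → P x → Q x) → (∀ {x} → Q x → P x) → ∀ xs → count P? xs ≡ count Q? xs
  count-cong P? Q? f g xs = ≤-antisym (count-mono P? Q? f xs) (count-mono Q? P? g xs)

  count-none : {P : A → Set} (P? : Decidable P) → (∀ {x} → ¬ P x) → ∀ xs → count P? xs ≡ 0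
  count-none P? ¬p [] = refl
  count-none P? ¬p (x ∷ xs) with P? x
  ... | yes p = contradiction p ¬p
  ... | no _  = count-none P? ¬p xs

  count-all : {P : A → Set} (P? : Decidable P) → (∀ {x} → P x) → ∀ xs → count P? xs ≡ length xs
  count-all P? p [] = refl
  count-all P? p (x ∷ xs) with P? x
  ... | yes _ = cong suc (count-all P? p xs)
  ... | no ¬p = contradiction p ¬p

  count-⊆ : {P Q : A → Set} (P? : Decidable P) (Q? : Decidable Q) {xs ys : List A} → Unique xs →
    (∀ {x} → x ∈ xs → P x → x ∈ ys × Q x) → count P? xs ≤ count Q? ys
  count-⊆ P? Q? u sub = unique-⊆⇒length-≤ (Unique-filter⁺ P? u) λ x∈ →
    let x∈xs , p = ∈-filter⁻ P? x∈ ; x∈ys , q = sub x∈xs p in ∈-filter⁺ Q? x∈ys q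

  count-accept : {P : A → Set} (P? : Decidable P) {x : A} → P x → ∀ xs → count P? (x ∷ xs) ≡ suc (count P? xs)
  count-accept P? {x} p xs with P? x
  ... | yes _ = refl
  ... | no ¬p = contradiction p ¬p

  count-reject : {P : A → Set} (P? : Decidable P) {x : A} → ¬ P x → ∀ xs → count P? (x ∷ xs) ≡ count P? xs
  count-reject P? {x} ¬p xs with P? x
  ... | yes p = contradiction p ¬p
  ... | no _ = refl

-- The abelian property of the sandpile model.

module Sandpile (G : Digraph) (s : Fin (Digraph.n G)) where
  open Digraph G

  infix 4 _⇒_ _⇒*_
  infixl 6 _+ᶜ_
  infix 8 _at_

  _⇒_ _⇒*_ : Config G → Config G → Set
  _⇒_  = LegalFiring G s
  _⇒*_ = Star _⇒_

  _+ᶜ_ : Config G → Config G → Config G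
  c +ᶜ d = _⊕_ G s c d

  _at_ : Config G → Fin n → ℕ
  c at v = lookup c v

  _∈?_ : (v : Fin n) (vs : List (Fin n)) → Dec (v ∈ vs)
  _∈?_ = mem? _≟_

  into : {X : Fin n → Set} → Decidable X → Fin n → ℕ
  into X? v = count (λ e → X? (src e) ×-dec (tgt e ≟ v)) (allFin m)

  +ᶜ-at : ∀ c d w → (c +ᶜ d) at w ≡ c at w + d at w
  +ᶜ-at c d w = lookup-zipWith _+_ w c d

  +ᶜ-comm : ∀ c d → c +ᶜ d ≡ d +ᶜ c
  +ᶜ-comm c d = lookup-ext λ w → begin
    (c +ᶜ d) at w   ≡⟨ +ᶜ-at c d w ⟩
    c at w + d at w ≡⟨ +-comm (c at w) (d at w) ⟩
    d at w + c at w ≡⟨ +ᶜ-at d c w ⟨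
    (d +ᶜ c) at w   ∎
    where open ≡-Reasoning

  +ᶜ-assoc : ∀ c d x → (c +ᶜ d) +ᶜ x ≡ c +ᶜ (d +ᶜ x)
  +ᶜ-assoc c d x = lookup-ext λ w → begin
    (c +ᶜ d +ᶜ x) at w           ≡⟨ +ᶜ-at (c +ᶜ d) x w ⟩
    (c +ᶜ d) at w + x at w       ≡⟨ cong (_+ x at w) (+ᶜ-at c d w) ⟩
    c at w + d at w + x at w     ≡⟨ +-assoc (c at w) (d at w) (x at w) ⟩
    c at w + (d at w + x at w)   ≡⟨ cong (c at w +_) (+ᶜ-at d x w) ⟨
    c at w + (d +ᶜ x) at w       ≡⟨ +ᶜ-at c (d +ᶜ x) w ⟨
    (c +ᶜ (d +ᶜ x)) at w         ∎
    where open ≡-Reasoning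

  load : Fin n → Fin n → ℕ
  load v w = if ⌊ w ≟ v ⌋ then outdeg G v else 0

  load-self : ∀ v → load v v ≡ outdeg G v
  load-self v = if-yes (v ≟ v) refl

  load-other : ∀ {v w} → w ≢ v → load v w ≡ 0
  load-other {v} {w} w≢v = if-no (w ≟ v) w≢v

  load-≤ : ∀ {c v} → outdeg G v ≤ c at v → ∀ w → load v w ≤ c at w
  load-≤ {c} {v} legal w with w ≟ v
  ... | yes refl = legal
  ... | no _ = z≤n

  fire-sink : ∀ c v → fire G s c v at s ≡ 0
  fire-sink c v = trans (lookup∘tabulate _ s) (if-yes (s ≟ s) refl)

  fire-at : ∀ c v {w} → w ≢ s → fire G s c v at w ≡ (c at w ∸ load v w) + mult G v w
  fire-at c v {w} w≢s = trans (lookup∘tabulate _ w) (if-no (w ≟ s) w≢s)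

  -- Legality makes the truncated subtraction in `fire` exact; moving `load` to the left removes it
  -- from later calculations.
  fire-balance : ∀ c {v w} → outdeg G v ≤ c at v → w ≢ s →
    fire G s c v at w + load v w ≡ c at w + mult G v w
  fire-balance c {v} {w} legal w≢s = begin
    fire G s c v at w + load v w                     ≡⟨ cong (_+ load v w) (fire-at c v w≢s) ⟩
    c at w ∸ load v w + mult G v w + load v w        ≡⟨ +-assoc (c at w ∸ load v w) _ _ ⟩
    c at w ∸ load v w + (mult G v w + load v w)      ≡⟨ cong (c at w ∸ load v w +_) (+-comm _ (load v w)) ⟩
    c at w ∸ load v w + (load v w + mult G v w)      ≡⟨ +-assoc (c at w ∸ load v w) _ _ ⟨
    c at w ∸ load v w + load v w + mult G v w        ≡⟨ cong (_+ mult G v w) (m∸n+n≡m (load-≤ {c} legal w)) ⟩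
    c at w + mult G v w                              ∎
    where open ≡-Reasoning

  fire-other : ∀ c {v w} → w ≢ s → w ≢ v → fire G s c v at w ≡ c at w + mult G v w
  fire-other c {v} w≢s w≢v =
    trans (fire-at c v w≢s) (cong (λ k → c at _ ∸ k + mult G v _) (load-other w≢v))

  fire-grows : ∀ c {v w} → w ≢ s → w ≢ v → c at w ≤ fire G s c v at w
  fire-grows c {v} w≢s w≢v = subst (c at _ ≤_) (sym (fire-other c w≢s w≢v)) (m≤m+n _ _)

  -- With both loads restored, the two orders have the same balance at every non-sink vertex, and
  -- the loads cancel. Since the vertices differ, the first firing only adds chips at the second,
  -- which therefore stays legal.
  fire-comm : ∀ c {v w} → v ≢ s → w ≢ s → v ≢ w → outdeg G v ≤ c at v → outdeg G w ≤ c at w →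
    fire G s (fire G s c v) w ≡ fire G s (fire G s c w) v
  fire-comm c {v} {w} v≢s w≢s v≢w lv lw = lookup-ext eq
    where
    open ≡-Reasoning
    two : ∀ {v w t} → w ≢ s → v ≢ w → outdeg G v ≤ c at v → outdeg G w ≤ c at w → t ≢ s →
      fire G s (fire G s c v) w at t + (load w t + load v t) ≡ c at t + (mult G v t + mult G w t)
    two {v} {w} {t} w≢s v≢w lv lw t≢s = begin
      cvw + (load w t + load v t)              ≡⟨ +-assoc cvw _ _ ⟨
      cvw + load w t + load v t                ≡⟨ cong (_+ load v t) (fire-balance (fire G s c v)
                                                    (≤-trans lw (fire-grows c w≢s (≢-sym v≢w))) t≢s) ⟩
      fire G s c v at t + mult G w t + load v t  ≡⟨ +-assoc (fire G s c v at t) _ _ ⟩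
      fire G s c v at t + (mult G w t + load v t)  ≡⟨ cong (fire G s c v at t +_) (+-comm (mult G w t) _) ⟩
      fire G s c v at t + (load v t + mult G w t)  ≡⟨ +-assoc (fire G s c v at t) _ _ ⟨
      fire G s c v at t + load v t + mult G w t  ≡⟨ cong (_+ mult G w t) (fire-balance c lv t≢s) ⟩
      c at t + mult G v t + mult G w t         ≡⟨ +-assoc (c at t) _ _ ⟩
      c at t + (mult G v t + mult G w t)       ∎
      where cvw = fire G s (fire G s c v) w at t
    eq : ∀ t → fire G s (fire G s c v) w at t ≡ fire G s (fire G s c w) v at t
    eq t with t ≟ s
    ... | yes refl = trans (fire-sink (fire G s c v) w) (sym (fire-sink (fire G s c w) v))
    ... | no t≢s = +-cancelʳ-≡ (load w t + load v t) _ _ (begin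
      fire G s (fire G s c v) w at t + (load w t + load v t)  ≡⟨ two w≢s v≢w lv lw t≢s ⟩
      c at t + (mult G v t + mult G w t)     ≡⟨ cong (c at t +_) (+-comm (mult G v t) _) ⟩
      c at t + (mult G w t + mult G v t)     ≡⟨ two v≢s (≢-sym v≢w) lw lv t≢s ⟨
      fire G s (fire G s c w) v at t + (load v t + load w t)  ≡⟨ cong (fire G s (fire G s c w) v at t +_) (+-comm (load v t) _) ⟩
      fire G s (fire G s c w) v at t + (load w t + load v t)  ∎)

  -- Legality at `c` lets the truncated subtraction commute with adding `x`; at the sink `x` has to
  -- vanish because `fire` resets that entry to 0.
  fire-+ᶜ : ∀ x c {v} → x at s ≡ 0 → outdeg G v ≤ c at v → fire G s (x +ᶜ c) v ≡ x +ᶜ fire G s c v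
  fire-+ᶜ x c {v} x₀ legal = lookup-ext eq
    where
    open ≡-Reasoning
    eq : ∀ w → fire G s (x +ᶜ c) v at w ≡ (x +ᶜ fire G s c v) at w
    eq w with w ≟ s
    ... | yes refl = begin
      fire G s (x +ᶜ c) v at s      ≡⟨ fire-sink (x +ᶜ c) v ⟩
      0                             ≡⟨ cong₂ _+_ x₀ (fire-sink c v) ⟨
      x at s + fire G s c v at s    ≡⟨ +ᶜ-at x (fire G s c v) s ⟨
      (x +ᶜ fire G s c v) at s      ∎
    ... | no w≢s = begin
      fire G s (x +ᶜ c) v at w                            ≡⟨ fire-at (x +ᶜ c) v w≢s ⟩
      (x +ᶜ c) at w ∸ load v w + mult G v w               ≡⟨ cong (λ k → k ∸ load v w + mult G v w) (+ᶜ-at x c w) ⟩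
      x at w + c at w ∸ load v w + mult G v w             ≡⟨ cong (_+ mult G v w) (+-∸-assoc (x at w) (load-≤ {c} legal w)) ⟩
      x at w + (c at w ∸ load v w) + mult G v w           ≡⟨ +-assoc (x at w) _ _ ⟩
      x at w + (c at w ∸ load v w + mult G v w)           ≡⟨ cong (x at w +_) (fire-at c v w≢s) ⟨
      x at w + fire G s c v at w                          ≡⟨ +ᶜ-at x (fire G s c v) w ⟨
      (x +ᶜ fire G s c v) at w                            ∎

  legal-+ᶜ : ∀ x {c v} → outdeg G v ≤ c at v → outdeg G v ≤ (x +ᶜ c) at v
  legal-+ᶜ x {c} {v} legal = subst (outdeg G v ≤_) (sym (+ᶜ-at x c v)) (≤-trans legal (m≤n+m _ _))

  ⇒*-+ᶜ : ∀ x {c d} → x at s ≡ 0 → c ⇒* d → x +ᶜ c ⇒* x +ᶜ d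
  ⇒*-+ᶜ x x₀ ε = ε
  ⇒*-+ᶜ x {c} x₀ ((v , v≢s , legal , refl) ◅ p) =
    (v , v≢s , legal-+ᶜ x {c} legal , sym (fire-+ᶜ x c x₀ legal)) ◅ ⇒*-+ᶜ x x₀ p

  -- A stabilising sequence may be reordered so as to start with any given legal firing.
  stabilise-after-firing : ∀ {c c′ d} → c ⇒* d → Stable G s d → c ⇒ c′ → c′ ⇒* d
  stabilise-after-firing ε st (v , v≢s , legal , _) = contradiction legal (<⇒≱ (st v v≢s))
  stabilise-after-firing {c} ((v , v≢s , lv , refl) ◅ p) st (w , w≢s , lw , refl) with v ≟ w
  ... | yes refl = p
  ... | no v≢w =
    (v , v≢s , ≤-trans lv (fire-grows c v≢s v≢w) , fire-comm c v≢s w≢s v≢w lv lw)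
    ◅ stabilise-after-firing p st (w , w≢s , ≤-trans lw (fire-grows c w≢s (≢-sym v≢w)) , refl)

  stabilise-after : ∀ {c c′ d} → c ⇒* d → Stable G s d → c ⇒* c′ → c′ ⇒* d
  stabilise-after p st ε       = p
  stabilise-after p st (f ◅ q) = stabilise-after (stabilise-after-firing p st f) st q

  stabilisation-unique : ∀ {c d d′} → Stabilizes G s c d → Stabilizes G s c d′ → d ≡ d′
  stabilisation-unique (p , st) (q , st′) with stabilise-after q st′ p
  ... | ε = refl
  ... | (v , v≢s , legal , _) ◅ _ = contradiction legal (<⇒≱ (st v v≢s))

  u : Config G
  u = uₛ G s

  u-sink : u at s ≡ 0
  u-sink = trans (lookup∘tabulate _ s) (if-yes (s ≟ s) refl)

  u-at : ∀ {w} → w ≢ s → u at w ≡ mult G s w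
  u-at {w} w≢s = trans (lookup∘tabulate _ w) (if-no (w ≟ s) w≢s)

  into-∷ : ∀ {v vs} → v ∉ vs → ∀ w → into (_∈? (v ∷ vs)) w ≡ mult G v w + into (_∈? vs) w
  into-∷ v∉vs w = count-⊎ _ _ _
    (λ { (here p , q) → inj₁ (p , q) ; (there p , q) → inj₂ (p , q) })
    (λ { (p , q) → here p , q }) (λ { (p , q) → there p , q })
    (λ { (refl , _) (p , _) → v∉vs p }) (allFin m)

  into-all : {X : Fin n → Set} (X? : Decidable X) → (∀ v → X v) → ∀ w → into X? w ≡ indeg G w
  into-all X? all w = count-cong _ _ proj₂ (λ q → all _ , q) (allFin m)

  into-≤-indeg : {X : Fin n → Set} (X? : Decidable X) → ∀ w → into X? w ≤ indeg G w
  into-≤-indeg X? w = count-mono _ _ proj₂ (allFin m)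

  edge⇒mult : ∀ e → 1 ≤ mult G (src e) (tgt e)
  edge⇒mult e = unique-⊆⇒length-≤ {xs = e ∷ []} ([] ∷ []) λ { (here refl) →
    ∈-filter⁺ _ (∈-allFin e) (refl , refl) }

  -- Burning orders on vertices.

  -- Dhar's burning algorithm with the latest vertex at the head. The bound in `burn` says that `v`
  -- can be fired once `uₛ` has been added and the earlier non-sink vertices have been fired.
  data BurnOrder (c : Config G) : List (Fin n) → Set where
    root : BurnOrder c (s ∷ [])
    burn : ∀ {v vs} → BurnOrder c vs → v ∉ vs → outdeg G v ≤ c at v + into (_∈? vs) v →
      BurnOrder c (v ∷ vs)

  s∈order : ∀ {c vs} → BurnOrder c vs → s ∈ vs
  s∈order root         = here refl
  s∈order (burn b _ _) = there (s∈order b)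

  -- Adding `uₛ` acts as a firing of the sink. So every vertex has received one chip per edge from a
  -- vertex of `vs`, and the members of `vs` other than `s` have given away their outdegree; the
  -- second clause is what makes the next firing legal.
  fire-order : ∀ {c vs} → BurnOrder c vs → ∃ λ d → c +ᶜ u ⇒* d ×
    (∀ {w} → w ≢ s → w ∈ vs → d at w + outdeg G w ≡ c at w + into (_∈? vs) w) ×
    (∀ {w} → w ≢ s → w ∉ vs → d at w ≡ c at w + into (_∈? vs) w)
  fire-order {c} root = c +ᶜ u , ε , (λ { w≢s (here p) → contradiction p w≢s }) , λ {w} w≢s _ →
    trans (+ᶜ-at c u w) (cong (c at w +_) (trans (u-at w≢s)
      (count-cong _ _ (λ (p , q) → here p , q) (λ { (here p , q) → p , q }) (allFin m))))
  fire-order {c} (burn {v} {vs} b v∉vs enough) with fire-order b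
  ... | d , p , fired , unfired = fire G s d v , p ◅◅ ((v , v≢s , legal , refl) ◅ ε) , fired′ , unfired′
    where
    open ≡-Reasoning
    v≢s : v ≢ s
    v≢s refl = v∉vs (s∈order b)
    legal : outdeg G v ≤ d at v
    legal = subst (outdeg G v ≤_) (sym (unfired v≢s v∉vs)) enough
    move : ∀ w → c at w + into (_∈? vs) w + mult G v w ≡ c at w + into (_∈? (v ∷ vs)) w
    move w = begin
      c at w + into (_∈? vs) w + mult G v w    ≡⟨ +-assoc (c at w) _ _ ⟩
      c at w + (into (_∈? vs) w + mult G v w)  ≡⟨ cong (c at w +_) (+-comm (into (_∈? vs) w) _) ⟩
      c at w + (mult G v w + into (_∈? vs) w)  ≡⟨ cong (c at w +_) (into-∷ v∉vs w) ⟨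
      c at w + into (_∈? (v ∷ vs)) w           ∎
    fired′ : ∀ {w} → w ≢ s → w ∈ v ∷ vs → fire G s d v at w + outdeg G w ≡ c at w + into (_∈? (v ∷ vs)) w
    fired′ {w} w≢s w∈ with w ≟ v | w∈
    ... | yes refl | _ = begin
      fire G s d v at v + outdeg G v          ≡⟨ cong (fire G s d v at v +_) (load-self v) ⟨
      fire G s d v at v + load v v            ≡⟨ fire-balance d legal w≢s ⟩
      d at v + mult G v v                     ≡⟨ cong (_+ mult G v v) (unfired w≢s v∉vs) ⟩
      c at v + into (_∈? vs) v + mult G v v   ≡⟨ move v ⟩
      c at v + into (_∈? (v ∷ vs)) v          ∎
    ... | no w≢v | here p = contradiction p w≢v
    ... | no w≢v | there w∈vs = begin
      fire G s d v at w + outdeg G w          ≡⟨ cong (_+ outdeg G w) (fire-other d w≢s w≢v) ⟩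
      d at w + mult G v w + outdeg G w        ≡⟨ +-assoc (d at w) _ _ ⟩
      d at w + (mult G v w + outdeg G w)      ≡⟨ cong (d at w +_) (+-comm (mult G v w) _) ⟩
      d at w + (outdeg G w + mult G v w)      ≡⟨ +-assoc (d at w) _ _ ⟨
      d at w + outdeg G w + mult G v w        ≡⟨ cong (_+ mult G v w) (fired w≢s w∈vs) ⟩
      c at w + into (_∈? vs) w + mult G v w   ≡⟨ move w ⟩
      c at w + into (_∈? (v ∷ vs)) w          ∎
    unfired′ : ∀ {w} → w ≢ s → w ∉ v ∷ vs → fire G s d v at w ≡ c at w + into (_∈? (v ∷ vs)) w
    unfired′ {w} w≢s w∉ = begin
      fire G s d v at w                       ≡⟨ fire-other d w≢s (λ p → w∉ (here p)) ⟩
      d at w + mult G v w                     ≡⟨ cong (_+ mult G v w) (unfired w≢s (λ p → w∉ (there p))) ⟩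
      c at w + into (_∈? vs) w + mult G v w   ≡⟨ move w ⟩
      c at w + into (_∈? (v ∷ vs)) w          ∎

  -- Recurrent configurations have no forbidden sets.

  separate : {X : Fin n → Set} {v w : Fin n} → X v → ¬ X w → v ≢ w
  separate v∈X w∉X refl = w∉X v∈X

  -- No set of non-sink vertices is forbidden: this is the recurrence test of the burning algorithm.
  Spreads : Config G → Set₁
  Spreads d = ∀ {X : Fin n → Set} (X? : Decidable X) → ¬ X s → ∃ X → ∃ λ v → X v × into X? v ≤ d at v

  -- If the fired vertex `w` is outside `X`, chips on `X` only increase. If it is inside, test `X`
  -- without `w`: the vertex found there gains exactly the edges from `w` that the larger set adds
  -- to its bound. If `X` is just `w`, the chips returned by the loops at `w` suffice.
  spreads-⇒ : ∀ {d d′} → d ⇒ d′ → Spreads d → Spreads d′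
  spreads-⇒ {d} (w , w≢s , legal , refl) sp {X} X? s∉X ∃X with X? w
  ... | no w∉X = let v , v∈X , le = sp X? s∉X ∃X in
    v , v∈X , ≤-trans le (fire-grows d (separate v∈X s∉X) (separate v∈X w∉X))
  ... | yes w∈X with any? (λ x → X? x ×-dec ¬? (x ≟ w))
  ...   | yes rest = let v , (v∈X , v≢w) , le = sp {λ x → X x × x ≢ w} (λ x → X? x ×-dec ¬? (x ≟ w)) (λ p → s∉X (proj₁ p)) rest in
    v , v∈X , subst₂ _≤_ (sym (split v)) (sym (fire-other d (separate v∈X s∉X) v≢w)) (+-monoˡ-≤ (mult G w v) le)
    where
    split : ∀ v → into X? v ≡ into (λ x → X? x ×-dec ¬? (x ≟ w)) v + mult G w v
    split v = count-⊎ _ _ _ (λ {e} (p , q) → cases e p q) (λ ((p , _) , q) → p , q)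
      (λ { (refl , q) → w∈X , q }) (λ ((_ , p) , _) (q , _) → p q) (allFin m)
      where
      cases : ∀ e → X (src e) → tgt e ≡ v → ((X (src e) × src e ≢ w) × tgt e ≡ v) ⊎ (src e ≡ w × tgt e ≡ v)
      cases e p q with src e ≟ w
      ... | yes r = inj₂ (r , q)
      ... | no ¬r = inj₁ ((p , ¬r) , q)
  ...   | no only = w , w∈X , ≤-trans (count-mono _ _ (λ {e} (p , q) → single e p , q) (allFin m))
      (subst (mult G w w ≤_) (sym (fire-at d w w≢s)) (m≤n+m _ _))
    where
    single : ∀ e → X (src e) → src e ≡ w
    single e p with src e ≟ w
    ... | yes r = r
    ... | no ¬r = contradiction (_ , p , ¬r) only

  spreads-⇒* : ∀ {d d′} → d ⇒* d′ → Spreads d → Spreads d′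
  spreads-⇒* ε sp       = sp
  spreads-⇒* {d} (f ◅ p) sp = spreads-⇒* p (spreads-⇒ {d} f sp)

  capacity : Config G
  capacity = tabulate λ w → if ⌊ w ≟ s ⌋ then 0 else outdeg G w

  capacity-sink : capacity at s ≡ 0
  capacity-sink = trans (lookup∘tabulate _ s) (if-yes (s ≟ s) refl)

  capacity-at : ∀ {w} → w ≢ s → capacity at w ≡ outdeg G w
  capacity-at {w} w≢s = trans (lookup∘tabulate _ w) (if-no (w ≟ s) w≢s)

  recurrent⇒stable : ∀ {c} → Recurrent G s c → Stable G s c
  recurrent⇒stable {c} (c₀ , rec) with rec c c₀
  ... | _ , _ , _ , st = st

  -- Apply the definition of recurrence to `capacity`. With outdegree many chips at each non-sink
  -- vertex no set is forbidden, since edges from inside a set number at most the indegree; legal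
  -- firings carry this over to `c`.
  recurrent⇒spreads : Eulerian G → ∀ {c} → Recurrent G s c → Spreads c
  recurrent⇒spreads eulerian (_ , rec) with rec capacity capacity-sink
  ... | c₂ , _ , p , _ = spreads-⇒* p λ X? s∉X (v , v∈X) → v , v∈X , (begin
    into X? v             ≤⟨ into-≤-indeg X? v ⟩
    indeg G v             ≡⟨ eulerian v ⟨
    outdeg G v            ≡⟨ capacity-at (separate v∈X s∉X) ⟨
    capacity at v         ≤⟨ m≤m+n _ _ ⟩
    capacity at v + c₂ at v  ≡⟨ +ᶜ-at capacity c₂ v ⟨
    (capacity +ᶜ c₂) at v ∎)
    where open ≤-Reasoning

  -- A full burning order makes a stable configuration recurrent.

  module Absorption (eulerian : Eulerian G) {c : Config G} (c₀ : SConfig G s c) (st : Stable G s c)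
    {vs : List (Fin n)} (order : BurnOrder c vs) (all : ∀ v → v ∈ vs) where

    -- The configurations acting trivially on `c`. Recurrence of `c` reduces to finding one that
    -- dominates a given `c₁` off the sink.
    Absorbed : Config G → Set
    Absorbed z = z at s ≡ 0 × (c +ᶜ z ⇒* c)

    fire-sink* : ∀ {d d′} → d at s ≡ 0 → d ⇒* d′ → d′ at s ≡ 0
    fire-sink* d₀ ε = d₀
    fire-sink* {d} d₀ ((v , _ , _ , refl) ◅ p) = fire-sink* (fire-sink d v) p

    absorb-u : Absorbed u
    absorb-u with fire-order order
    ... | d , p , fired , _ = u-sink , subst (c +ᶜ u ⇒*_) (lookup-ext eq) p
      where
      eq : ∀ w → d at w ≡ c at w
      eq w with w ≟ s
      ... | yes refl = trans (fire-sink* (trans (+ᶜ-at c u s) (cong₂ _+_ c₀ u-sink)) p) (sym c₀)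
      ... | no w≢s = +-cancelʳ-≡ (outdeg G w) _ _ (trans (fired w≢s (all w))
        (cong (c at w +_) (trans (into-all (_∈? vs) all w) (sym (eulerian w)))))

    absorb-+ : ∀ {z z′} → Absorbed z → Absorbed z′ → Absorbed (z′ +ᶜ z)
    absorb-+ {z} {z′} (z₀ , p) (z′₀ , p′) = trans (+ᶜ-at z′ z s) (cong₂ _+_ z′₀ z₀) ,
      subst (_⇒* c) (eq z′) (⇒*-+ᶜ z′ z′₀ p ◅◅ subst (_⇒* c) (+ᶜ-comm c z′) p′)
      where
      open ≡-Reasoning
      eq : ∀ x → x +ᶜ (c +ᶜ z) ≡ c +ᶜ (x +ᶜ z)
      eq x = begin
        x +ᶜ (c +ᶜ z)  ≡⟨ +ᶜ-assoc x c z ⟨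
        (x +ᶜ c) +ᶜ z  ≡⟨ cong (_+ᶜ z) (+ᶜ-comm x c) ⟩
        (c +ᶜ x) +ᶜ z  ≡⟨ +ᶜ-assoc c x z ⟩
        c +ᶜ (x +ᶜ z)  ∎

    absorb-scale : ∀ k {z} → Absorbed z → Absorbed (scale G s k z)
    absorb-scale zero {z} _ = lookup∘tabulate _ s , subst (_⇒* c) (lookup-ext eq) ε
      where
      eq : ∀ w → c at w ≡ (c +ᶜ scale G s 0 z) at w
      eq w = sym (trans (+ᶜ-at c _ w) (trans (cong (c at w +_) (lookup∘tabulate _ w)) (+-identityʳ _)))
    absorb-scale (suc k) {z} az = subst Absorbed (lookup-ext eq) (absorb-+ (absorb-scale k az) az)
      where
      eq : ∀ w → (z +ᶜ scale G s k z) at w ≡ scale G s (suc k) z at w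
      eq w = trans (+ᶜ-at z _ w) (trans (cong (z at w +_) (lookup∘tabulate _ w)) (sym (lookup∘tabulate _ w)))

    -- The firing is legal in `c +ᶜ z` as well, and the stabilisation of that sum to `c` can be
    -- reordered to start with it.
    absorb-fire : ∀ {z v} → v ≢ s → outdeg G v ≤ z at v → Absorbed z → Absorbed (fire G s z v)
    absorb-fire {z} {v} v≢s legal (z₀ , p) = fire-sink z v ,
      stabilise-after-firing p st (v , v≢s , legal-+ᶜ c {z} legal , sym (fire-+ᶜ c z c₀ legal))

    -- Stability gives `v` fewer chips than its outdegree, so its place in the burning order
    -- requires an edge from an earlier vertex `x`. If `x` is the sink, `u` itself has a chip at
    -- `v`. Otherwise outdegree many copies of a configuration with a chip at `x` make `x` fireable,
    -- and firing it sends a chip to `v`.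
    cover-vertex : ∀ {us} → BurnOrder c us → ∀ {v} → v ∈ us → v ≢ s → ∃ λ z → Absorbed z × 1 ≤ z at v
    cover-vertex root (here p) v≢s = contradiction p v≢s
    cover-vertex (burn b v∉us enough) (there p) v≢s = cover-vertex b p v≢s
    cover-vertex (burn {v} {us} b v∉us enough) (here refl) v≢s
      with any? (λ e → (src e ∈? us) ×-dec (tgt e ≟ v))
    ... | no none = contradiction (begin-strict
        outdeg G v                      ≤⟨ enough ⟩
        c at v + into (_∈? us) v        ≡⟨ cong (c at v +_) (count-none _ (λ p → none (_ , p)) (allFin m)) ⟩
        c at v + 0                      ≡⟨ +-identityʳ _ ⟩
        c at v                          <⟨ st v v≢s ⟩
        outdeg G v                      ∎) (<-irrefl refl)
      where open ≤-Reasoning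
    ... | yes (e , x∈us , refl) with src e ≟ s
    ...   | yes x≡s = u , absorb-u ,
      subst (1 ≤_) (trans (cong (λ x → mult G x (tgt e)) x≡s) (sym (u-at v≢s))) (edge⇒mult e)
    ...   | no x≢s = fire G s (scale G s N z) x , absorb-fire x≢s legal (absorb-scale N az) ,
        ≤-trans (edge⇒mult e) (subst (mult G x (tgt e) ≤_) (sym (fire-at (scale G s N z) x v≢s)) (m≤n+m _ _))
      where
      x = src e
      N = outdeg G x
      IH = cover-vertex b x∈us x≢s
      z = proj₁ IH
      az = proj₁ (proj₂ IH)
      legal : N ≤ scale G s N z at x
      legal = subst (N ≤_) (sym (lookup∘tabulate _ x))
        (subst (_≤ N * z at x) (*-identityʳ N) (*-monoʳ-≤ N (proj₂ (proj₂ IH))))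

    cover : ∀ (c₁ : Config G) us → ∃ λ z → Absorbed z × (∀ {v} → v ∈ us → v ≢ s → c₁ at v ≤ z at v)
    cover c₁ [] = scale G s 0 u , absorb-scale 0 absorb-u , λ ()
    cover c₁ (w ∷ us) with cover c₁ us | w ≟ s
    ... | z , az , ge | yes refl = z , az , λ { (here p) v≢s → contradiction p v≢s ; (there p) → ge p }
    ... | z , az , ge | no w≢s with cover-vertex order (all w) w≢s
    ...   | y , ay , pos = y′ +ᶜ z , absorb-+ az (absorb-scale (c₁ at w) ay) , ge′
      where
      open ≤-Reasoning
      y′ = scale G s (c₁ at w) y
      ge′ : ∀ {v} → v ∈ w ∷ us → v ≢ s → c₁ at v ≤ (y′ +ᶜ z) at v
      ge′ (here refl) _ = begin
        c₁ at w                 ≡⟨ *-identityʳ _ ⟨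
        c₁ at w * 1             ≤⟨ *-monoʳ-≤ (c₁ at w) pos ⟩
        c₁ at w * y at w        ≡⟨ lookup∘tabulate _ w ⟨
        y′ at w                 ≤⟨ m≤m+n _ _ ⟩
        y′ at w + z at w        ≡⟨ +ᶜ-at y′ z w ⟨
        (y′ +ᶜ z) at w          ∎
      ge′ {v} (there p) v≢s = begin
        c₁ at v                 ≤⟨ ge p v≢s ⟩
        z at v                  ≤⟨ m≤n+m _ _ ⟩
        y′ at v + z at v        ≡⟨ +ᶜ-at y′ z v ⟨
        (y′ +ᶜ z) at v          ∎

    recurrent : Recurrent G s c
    recurrent = c₀ , λ c₁ c₁₀ → reach c₁ c₁₀ (cover c₁ (allFin n))
      where
      reach : ∀ c₁ → SConfig G s c₁ →
        (∃ λ z → Absorbed z × (∀ {v} → v ∈ allFin n → v ≢ s → c₁ at v ≤ z at v)) →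
        ∃ λ c₂ → SConfig G s c₂ × Stabilizes G s (c₁ +ᶜ c₂) c
      reach c₁ c₁₀ (z , (z₀ , p) , ge) = c₂ , c₂-sink , subst (_⇒* c) (lookup-ext eq) p , st
        where
        open ≡-Reasoning
        c₂ : Config G
        -- Chosen so that `c₁ +ᶜ c₂` is `c +ᶜ z`; the subtraction is exact because `z` dominates
        -- `c₁` off the sink and `c₁` vanishes at it.
        c₂ = tabulate λ w → (c at w + z at w) ∸ c₁ at w
        c₂-sink : c₂ at s ≡ 0
        c₂-sink = trans (lookup∘tabulate _ s) (cong₂ _∸_ (cong₂ _+_ c₀ z₀) c₁₀)
        le : ∀ w → c₁ at w ≤ c at w + z at w
        le w with w ≟ s
        ... | yes refl = subst (_≤ c at s + z at s) (sym c₁₀) z≤n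
        ... | no w≢s = ≤-trans (ge (∈-allFin w) w≢s) (m≤n+m _ _)
        eq : ∀ w → (c +ᶜ z) at w ≡ (c₁ +ᶜ c₂) at w
        eq w = begin
          (c +ᶜ z) at w          ≡⟨ +ᶜ-at c z w ⟩
          c at w + z at w        ≡⟨ m+[n∸m]≡n (le w) ⟨
          c₁ at w + ((c at w + z at w) ∸ c₁ at w)  ≡⟨ cong (c₁ at w +_) (lookup∘tabulate _ w) ⟨
          c₁ at w + c₂ at w      ≡⟨ +ᶜ-at c₁ c₂ w ⟨
          (c₁ +ᶜ c₂) at w        ∎

    ∼-reflexive : _∼_ G s c c
    ∼-reflexive = 0 , proj₂ (absorb-scale 0 absorb-u) , st

    ∼⇒≡ : ∀ {d} → _∼_ G s c d → c ≡ d
    ∼⇒≡ (k , p) = stabilisation-unique (proj₂ (absorb-scale k absorb-u) , st) p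

-- Suffixes of a list as stages of a process.

infix 4 _⊑_

-- The suffix order. Processed elements are added at the head, so a suffix is an earlier stage, and
-- `x ∷ xs ⊑ ys` records that `x` was processed directly after stage `xs`.
data _⊑_ {A : Set} (xs : List A) : List A → Set where
  whole : xs ⊑ xs
  later : ∀ {y ys} → xs ⊑ ys → xs ⊑ (y ∷ ys)

module _ {A : Set} where

  ⊑-trans : {xs ys zs : List A} → xs ⊑ ys → ys ⊑ zs → xs ⊑ zs
  ⊑-trans p whole     = p
  ⊑-trans p (later q) = later (⊑-trans p q)

  ⊑-tail : {x : A} {xs ys : List A} → x ∷ xs ⊑ ys → xs ⊑ ys
  ⊑-tail p = ⊑-trans (later whole) p

  ⊑-∈ : {x : A} {xs ys : List A} → xs ⊑ ys → x ∈ xs → x ∈ ys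
  ⊑-∈ whole x∈     = x∈
  ⊑-∈ (later p) x∈ = there (⊑-∈ p x∈)

  ∈⇒⊑ : {x : A} {ys : List A} → x ∈ ys → ∃ λ xs → x ∷ xs ⊑ ys
  ∈⇒⊑ (here refl) = _ , whole
  ∈⇒⊑ (there x∈)  = let xs , p = ∈⇒⊑ x∈ in xs , later p

  []⊑ : (ys : List A) → [] ⊑ ys
  []⊑ []       = whole
  []⊑ (_ ∷ ys) = later ([]⊑ ys)

  ⊑-compare : {x : A} {xs ys zs : List A} → x ∷ xs ⊑ ys → zs ⊑ ys → x ∷ xs ⊑ zs ⊎ zs ⊑ xs
  ⊑-compare p         whole     = inj₁ p
  ⊑-compare whole     (later q) = inj₂ q
  ⊑-compare (later p) (later q) = ⊑-compare p q

  ⊑-split : {xs ys : List A} → xs ⊑ ys → xs ≡ ys ⊎ ∃ λ y → y ∷ xs ⊑ ys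
  ⊑-split whole = inj₁ refl
  ⊑-split (later p) with ⊑-split p
  ... | inj₁ refl    = inj₂ (_ , whole)
  ... | inj₂ (y , q) = inj₂ (y , later q)

  ⊑-unique : {xs ys : List A} → xs ⊑ ys → Unique ys → Unique xs
  ⊑-unique whole u           = u
  ⊑-unique (later p) (_ ∷ u) = ⊑-unique p u

  ⊑-∉ : {x : A} {xs ys zs : List A} → x ∷ xs ⊑ ys → zs ⊑ ys → x ∉ zs → zs ⊑ xs
  ⊑-∉ p q x∉ with ⊑-compare p q
  ... | inj₁ r = contradiction (⊑-∈ r (here refl)) x∉
  ... | inj₂ r = r

  ⊑-∋ : {x : A} {xs ys zs : List A} → Unique ys → x ∷ xs ⊑ ys → zs ⊑ ys → x ∈ zs → x ∷ xs ⊑ zs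
  ⊑-∋ u p q x∈ with ⊑-compare p q
  ... | inj₁ r = r
  ... | inj₂ r = contradiction (⊑-∈ r x∈) (Unique[x∷xs]⇒x∉xs (⊑-unique p u))

  module _ {P : List A → A → Set} (P? : ∀ xs x → Dec (P xs x)) where

    -- A filter whose test also sees the stage at which the element was processed; lateness and
    -- ignition are such properties.
    select : List A → List A
    select []       = []
    select (x ∷ xs) = if does (P? xs x) then x ∷ select xs else select xs

    ∈-select⁻ : ∀ {x ys} → x ∈ select ys → ∃ λ xs → x ∷ xs ⊑ ys × P xs x
    ∈-select⁻ {ys = y ∷ ys} x∈ with P? ys y | x∈
    ... | no _  | x∈′       = let xs , p , px = ∈-select⁻ x∈′ in xs , later p , px
    ... | yes _ | there x∈′ = let xs , p , px = ∈-select⁻ x∈′ in xs , later p , px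
    ... | yes p | here refl = ys , whole , p

    ∈-select⁺ : ∀ {x xs ys} → x ∷ xs ⊑ ys → P xs x → x ∈ select ys
    ∈-select⁺ {x} {xs} whole px with P? xs x
    ... | yes _ = here refl
    ... | no ¬p = contradiction px ¬p
    ∈-select⁺ {ys = y ∷ ys} (later p) px with P? ys y
    ... | yes _ = there (∈-select⁺ p px)
    ... | no _  = ∈-select⁺ p px

    select-unique : ∀ {ys} → Unique ys → Unique (select ys)
    select-unique [] = []
    select-unique {y ∷ ys} (y∉ ∷ u) with P? ys y
    ... | yes _ = All-tabulate (λ x∈ → let _ , p , _ = ∈-select⁻ x∈ in All-lookup y∉ (⊑-∈ p (here refl))) ∷ select-unique u
    ... | no _  = select-unique u

  select-cong : {P Q : List A → A → Set} (P? : ∀ xs x → Dec (P xs x)) (Q? : ∀ xs x → Dec (Q xs x)) → ∀ ys →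
    (∀ {x xs} → x ∷ xs ⊑ ys → P xs x → Q xs x) → (∀ {x xs} → x ∷ xs ⊑ ys → Q xs x → P xs x) →
    select P? ys ≡ select Q? ys
  select-cong P? Q? [] f g = refl
  select-cong P? Q? (y ∷ ys) f g
    with P? ys y | Q? ys y | select-cong P? Q? ys (λ p → f (later p)) (λ p → g (later p))
  ... | yes _ | yes _ | ih = cong (y ∷_) ih
  ... | yes p | no ¬q | _  = contradiction (f whole p) ¬q
  ... | no ¬p | yes q | _  = contradiction (g whole q) ¬p
  ... | no _  | no _  | ih = ih

-- The burning process on edges for an arbitrary rule.

module Burning (G : Digraph) (s : Fin (Digraph.n G)) where
  open Digraph G

  Edges : Set
  Edges = List (Fin m)

  -- The edges are processed one after the other; a list of edges records the
  -- processed ones, the most recent first.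
  record Rule : Set₁ where
    field
      Burnt   : Edges → Fin n → Set
      burnt?  : ∀ L v → Dec (Burnt L v)
      sink    : ∀ {L} → Burnt L s
      mono    : ∀ {e L v} → Burnt L v → Burnt (e ∷ L) v
      local   : ∀ {e L v} → Burnt (e ∷ L) v → ¬ Burnt L v → tgt e ≡ v
      initial : ∀ {v} → Burnt [] v → v ≡ s

  Complete : Edges → Set
  Complete L = ∀ e → e ∈ L

  arrivals : Edges → Fin n → ℕ
  arrivals L v = count (λ e → tgt e ≟ v) L

  arrivals-complete : ∀ {L} → Unique L → Complete L → ∀ v → arrivals L v ≡ indeg G v
  arrivals-complete u complete v = ≤-antisym
    (count-⊆ _ _ u (λ {e} _ p → ∈-allFin e , p))
    (count-⊆ _ _ (allFin⁺ m) (λ {e} _ p → complete e , p))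

  arrivals-⊑ : ∀ {L′ L} → L′ ⊑ L → ∀ v → arrivals L′ v ≤ arrivals L v
  arrivals-⊑ whole v = ≤-refl
  arrivals-⊑ (later {e} p) v with tgt e ≟ v
  ... | yes _ = m≤n⇒m≤1+n (arrivals-⊑ p v)
  ... | no _  = arrivals-⊑ p v

  module Process (R : Rule) where
    open Rule R

    Available : Edges → Fin m → Set
    Available L e = e ∉ L × Burnt L (src e)

    data Run : Edges → Set where
      []   : Run []
      step : ∀ {e L} → Run L → Available L e → (∀ {f} → Available L f → f ≤ᶠ e) → Run (e ∷ L)

    available? : ∀ L → Decidable (Available L)
    available? L e = ¬? (mem? _≟_ e L) ×-dec burnt? L (src e)

    mono* : ∀ {L′ L v} → L′ ⊑ L → Burnt L′ v → Burnt L v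
    mono* whole b     = b
    mono* (later p) b = mono (mono* p b)

    run-⊑ : ∀ {L′ L} → L′ ⊑ L → Run L → Run L′
    run-⊑ whole r              = r
    run-⊑ (later p) (step r _ _) = run-⊑ p r

    run-unique : ∀ {L} → Run L → Unique L
    run-unique [] = []
    run-unique (step r (e∉ , _) _) = All-tabulate (λ f∈ → λ { refl → e∉ f∈ }) ∷ run-unique r

    run-src : ∀ {L e} → Run L → e ∈ L → Burnt L (src e)
    run-src (step _ (_ , b) _) (here refl) = mono b
    run-src (step r _ _) (there e∈)        = mono (run-src r e∈)

    -- The state determines the next edge, as the greatest available one, so two runs cannot part
    -- before one of them ends.
    runs-nested : ∀ {L L′} → Run L → Run L′ → L ⊑ L′ ⊎ L′ ⊑ L
    runs-nested {L′ = L′} [] _ = inj₁ ([]⊑ L′)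
    runs-nested {e ∷ L} (step r av max) r′ with runs-nested r r′
    ... | inj₂ p = inj₂ (later p)
    ... | inj₁ p with ⊑-split p
    ...   | inj₁ refl = inj₂ (later whole)
    ...   | inj₂ (f , q) with run-⊑ q r′
    ...     | step _ av′ max′ = inj₁ (subst (λ x → x ∷ L ⊑ _) (≤ᶠ-antisym (max av′) (max′ av)) q)

    complete-maximal : ∀ {L L′} → L ⊑ L′ → Run L′ → Complete L → L ≡ L′
    complete-maximal whole _ _ = refl
    complete-maximal (later p) (step {e} _ (e∉ , _) _) c = contradiction (⊑-∈ p (c e)) e∉

    Stuck : Edges → Set
    Stuck L = ∀ e → ¬ Available L e

    -- `k` is fuel bounding the number of unprocessed edges. With none left, a further step would
    -- give more than `m` distinct edges.
    extend-run : ∀ k {L} → Run L → m ≤ k + length L → ∃ λ L′ → Run L′ × Stuck L′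
    extend-run k {L} r le with greatest (available? L)
    ... | inj₂ stuck = L , r , stuck
    extend-run (suc k) {L} r le | inj₁ (e , av , max) =
      extend-run k (step r av max) (subst (m ≤_) (sym (+-suc k (length L))) le)
    extend-run zero {L} r le | inj₁ (e , av , max) = contradiction
      (≤-trans (unique-⊆⇒length-≤ {ys = allFin m} (run-unique (step r av max)) (λ {f} _ → ∈-allFin f))
        (≤-trans (≤-reflexive (length-tabulate _)) le)) (<-irrefl refl)

    final-run : ∃ λ L → Run L × Stuck L
    final-run = extend-run m [] (m≤m+n m 0)

    final : Edges
    final = proj₁ final-run

    run-final : Run final
    run-final = proj₁ (proj₂ final-run)

    stuck-final : Stuck final
    stuck-final = proj₂ (proj₂ final-run)

    stuck⇒complete : ∀ {L} → Stuck L → (∀ v → Burnt L v) → Complete L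
    stuck⇒complete {L} stuck burnt e with mem? _≟_ e L
    ... | yes e∈ = e∈
    ... | no e∉  = contradiction (e∉ , burnt (src e)) (stuck e)

    -- Recognises a run obtained from another rule as the final one: the two are nested, a complete
    -- run leaves no edge to add, and a stuck run admits no step.
    final-complete : ∀ {L} → Run L → Complete L → final ≡ L
    final-complete r c with runs-nested run-final r
    ... | inj₂ p = sym (complete-maximal p run-final c)
    ... | inj₁ p with ⊑-split p
    ...   | inj₁ eq = eq
    ...   | inj₂ (e , q) with run-⊑ q r
    ...     | step _ av _ = contradiction av (stuck-final e)

    late : Edges → Edges
    late = select (λ L e → burnt? L (tgt e))

    lateAt : Edges → Fin n → ℕ
    lateAt L v = count (λ e → tgt e ≟ v) (late L)

    lateAt-elsewhere : ∀ {e v} L → tgt e ≢ v → lateAt (e ∷ L) v ≡ lateAt L v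
    lateAt-elsewhere {e} L e≢v with burnt? L (tgt e)
    ... | yes _ = count-reject _ e≢v (late L)
    ... | no _  = refl

    lateAt-burnt : ∀ {e} L → Burnt L (tgt e) → lateAt (e ∷ L) (tgt e) ≡ suc (lateAt L (tgt e))
    lateAt-burnt {e} L b with burnt? L (tgt e)
    ... | yes _ = count-accept _ refl (late L)
    ... | no ¬b = contradiction b ¬b

    lateAt-ignition : ∀ {e} v L → ¬ Burnt L (tgt e) → lateAt (e ∷ L) v ≡ lateAt L v
    lateAt-ignition {e} v L ¬b with burnt? L (tgt e)
    ... | yes b = contradiction b ¬b
    ... | no _  = refl

    lateAt-unburnt : ∀ L {v} → ¬ Burnt L v → lateAt L v ≡ 0
    lateAt-unburnt [] _ = refl
    lateAt-unburnt (e ∷ L) {v} ¬b with tgt e ≟ v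
    ... | yes refl = trans (lateAt-ignition v L (λ b → ¬b (mono b))) (lateAt-unburnt L (λ b → ¬b (mono b)))
    ... | no e≢v   = trans (lateAt-elsewhere L e≢v) (lateAt-unburnt L (λ b → ¬b (mono b)))

    -- Once `v` burns, every further edge into it is late, so late edges and arrivals grow together.
    -- The additive form avoids subtraction.
    after-burning : ∀ {L′ L v} → L′ ⊑ L → Burnt L′ v →
      lateAt L v + arrivals L′ v ≡ lateAt L′ v + arrivals L v
    after-burning whole b = refl
    after-burning {L′} {e ∷ L} {v} (later p) b with tgt e ≟ v
    ... | no e≢v = trans (cong (_+ arrivals L′ v) (lateAt-elsewhere L e≢v)) (after-burning p b)
    ... | yes refl = trans (cong (_+ arrivals L′ v) (lateAt-burnt L (mono* p b)))
      (trans (cong suc (after-burning p b)) (sym (+-suc (lateAt L′ v) (arrivals L v))))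

    -- Strict because the edge that ignites v is counted on the right only.
    before-burning : ∀ {L′ L v} → L′ ⊑ L → ¬ Burnt L′ v → Burnt L v →
      lateAt L v + arrivals L′ v < arrivals L v
    before-burning whole ¬b b = contradiction b ¬b
    before-burning {L′} {e ∷ L} {v} (later p) ¬b′ b with burnt? L v
    ... | no ¬b with refl ← local b ¬b = begin-strict
        lateAt (e ∷ L) v + arrivals L′ v  ≡⟨ cong (_+ arrivals L′ v) (trans (lateAt-ignition v L ¬b) (lateAt-unburnt L ¬b)) ⟩
        arrivals L′ v                     <⟨ s≤s (arrivals-⊑ p v) ⟩
        suc (arrivals L v)                ≡⟨ count-accept (λ e → tgt e ≟ v) {x = e} refl L ⟨
        arrivals (e ∷ L) v                ∎
      where open ≤-Reasoning
    ... | yes bL with tgt e ≟ v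
    ...   | no e≢v = subst (λ k → k + arrivals L′ v < arrivals L v) (sym (lateAt-elsewhere L e≢v)) (before-burning p ¬b′ bL)
    ...   | yes refl = subst (λ k → k + arrivals L′ v < suc (arrivals L v)) (sym (lateAt-burnt L bL)) (s≤s (before-burning p ¬b′ bL))

    Ignites : Edges → Fin m → Set
    Ignites L e = ¬ Burnt L (tgt e) × Burnt (e ∷ L) (tgt e)

    ignites? : ∀ L e → Dec (Ignites L e)
    ignites? L e = ¬? (burnt? L (tgt e)) ×-dec burnt? (e ∷ L) (tgt e)

    ignition : ∀ {L v} → Burnt L v → v ≢ s → ∃ λ e → ∃ λ L′ → e ∷ L′ ⊑ L × tgt e ≡ v × Ignites L′ e
    ignition {[]} b v≢s = contradiction (initial b) v≢s
    ignition {e ∷ L} {v} b v≢s with burnt? L v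
    ... | yes b′ = let f , L′ , p , q = ignition b′ v≢s in f , L′ , later p , q
    ... | no ¬b with refl ← local b ¬b = e , L , whole , refl , ¬b , b

    ignitions : Edges → Subset m
    ignitions L = tabulate λ e → does (mem? _≟_ e (select ignites? L))

    ∈-ignitions⁺ : ∀ {e L′ L} → e ∷ L′ ⊑ L → Ignites L′ e → e ∈ˢ ignitions L
    ∈-ignitions⁺ {e} {L′} {L} p ig = lookup⇒[]= e _ (trans (lookup∘tabulate _ e) (dec-true (mem? _≟_ e _) (∈-select⁺ ignites? p ig)))

    ∈-ignitions⁻ : ∀ L {e} → e ∈ˢ ignitions L → ∃ λ L′ → e ∷ L′ ⊑ L × Ignites L′ e
    ∈-ignitions⁻ L {e} e∈ = ∈-select⁻ ignites? (toMember (mem? _≟_ e _) (trans (sym (lookup∘tabulate _ e)) ([]=⇒lookup e∈)))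
      where
      toMember : {P : Set} (d : Dec P) → does d ≡ true → P
      toMember (yes p) _ = p

    ignitions-avoid-s : ∀ L {e} → e ∈ˢ ignitions L → tgt e ≢ s
    ignitions-avoid-s L e∈ eq = let _ , _ , ¬b , _ = ∈-ignitions⁻ L e∈ in ¬b (subst (Burnt _) (sym eq) sink)

    -- Of two igniting edges with a common target, the later one would find it already burnt.
    ignitions-injective : ∀ L {e f} → e ∈ˢ ignitions L → f ∈ˢ ignitions L → tgt e ≡ tgt f → e ≡ f
    ignitions-injective L e∈ f∈ eq with ∈-ignitions⁻ L e∈ | ∈-ignitions⁻ L f∈
    ... | L′ , p , ¬b , b | L″ , q , ¬b′ , b′ with ⊑-compare p q
    ...   | inj₁ whole     = refl
    ...   | inj₁ (later r) = contradiction (subst (Burnt L″) eq (mono* r b)) ¬b′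
    ...   | inj₂ r         = contradiction (subst (Burnt L′) (sym eq) (mono* r b′)) ¬b

  -- Comparison of rules, and trees as rules.

  open Rule using (Burnt; burnt?; sink; mono; local; initial)
  open Process using (Run; []; step; late; lateAt; ignitions; final)

  Spanning : Rule → Edges → Set
  Spanning R L = ∀ v → Burnt R L v

  -- Agreement is asked only at the stages of `L`; elsewhere the rules may differ. This is all that
  -- the run, its late edges and its igniting edges depend on.
  record Agree (R R′ : Rule) (L : Edges) : Set where
    field
      to   : ∀ {L′ v} → L′ ⊑ L → Burnt R L′ v → Burnt R′ L′ v
      from : ∀ {L′ v} → L′ ⊑ L → Burnt R′ L′ v → Burnt R L′ v
  open Agree

  agree-tail : ∀ {R R′ e L} → Agree R R′ (e ∷ L) → Agree R R′ L
  agree-tail a = record { to = λ p → to a (later p) ; from = λ p → from a (later p) }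

  run-cong : ∀ {R R′ L} → Agree R R′ L → Run R L → Run R′ L
  run-cong a [] = []
  run-cong a (step r (e∉ , b) max) = step (run-cong (agree-tail a) r) (e∉ , to a (later whole) b)
    λ (f∉ , b′) → max (f∉ , from a (later whole) b′)

  late-cong : ∀ {R R′ L} → Agree R R′ L → late R L ≡ late R′ L
  late-cong {R} {R′} {L} a = select-cong _ _ L (λ p → to a (⊑-tail p)) (λ p → from a (⊑-tail p))

  ignitions-cong : ∀ {R R′ L} → Agree R R′ L → ignitions R L ≡ ignitions R′ L
  ignitions-cong {R} {R′} {L} a = cong (λ es → tabulate λ e → does (mem? _≟_ e es)) (select-cong _ _ L
    (λ p (¬b , b) → (λ b′ → ¬b (from a (⊑-tail p) b′)) , to a p b)
    (λ p (¬b , b) → (λ b′ → ¬b (to a (⊑-tail p) b′)) , from a p b))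

  treeRule : Subset m → Rule
  treeRule S = record
    { Burnt   = λ L v → v ≡ s ⊎ ∃ λ e → e ∈ L × e ∈ˢ S × tgt e ≡ v
    ; burnt?  = λ L v → (v ≟ s) ⊎-dec any? (λ e → mem? _≟_ e L ×-dec ((e ∈ˢ? S) ×-dec (tgt e ≟ v)))
    ; sink    = inj₁ refl
    ; mono    = [ inj₁ , (λ (e , e∈ , q) → inj₂ (e , there e∈ , q)) ]′
    ; local   = λ { (inj₁ p) ¬b → contradiction (inj₁ p) ¬b
                  ; (inj₂ (e , here refl , _ , p)) ¬b → p
                  ; (inj₂ (e , there e∈ , q)) ¬b → contradiction (inj₂ (e , e∈ , q)) ¬b }
    ; initial = λ { (inj₁ p) → p ; (inj₂ (_ , () , _)) }
    }

  -- Under `R` a vertex other than `s` is burnt at a stage exactly when its igniting edge is among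
  -- the processed ones. Distinctness of the processed edges fixes when that edge was processed.
  agree-treeRule : ∀ {R L} → Run R L → Agree R (treeRule (ignitions R L)) L
  agree-treeRule {R} {L} r = record { to = to′ ; from = from′ }
    where
    open Process R using (ignition; ∈-ignitions⁺; ∈-ignitions⁻; mono*; run-unique)
    S = ignitions R L
    to′ : ∀ {L′ v} → L′ ⊑ L → Burnt R L′ v → Burnt (treeRule S) L′ v
    to′ {L′} {v} p b with v ≟ s
    ... | yes eq = inj₁ eq
    ... | no v≢s with ignition b v≢s
    ...   | e , _ , q , eq , ig = inj₂ (e , ⊑-∈ q (here refl) , ∈-ignitions⁺ (⊑-trans q p) ig , eq)
    from′ : ∀ {L′ v} → L′ ⊑ L → Burnt (treeRule S) L′ v → Burnt R L′ v
    from′ p (inj₁ refl) = sink R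
    from′ p (inj₂ (e , e∈L′ , e∈S , refl)) with ∈-ignitions⁻ L e∈S
    ... | _ , q , _ , b = mono* (⊑-∋ (run-unique r) q p e∈L′) b

  -- A decidable form of `Arborescence` that avoids quantifying over paths, so that arborescences
  -- can be enumerated by filtering all subsets; reachability from `s` is tested by the burning
  -- process itself.
  record Tree (S : Subset m) : Set where
    field
      avoids-s  : ∀ e → e ∈ˢ S → tgt e ≢ s
      injective : ∀ e f → e ∈ˢ S → f ∈ˢ S → tgt e ≡ tgt f → e ≡ f
      spanning  : Spanning (treeRule S) (final (treeRule S))

    complete : Complete (final (treeRule S))
    complete = Process.stuck⇒complete (treeRule S) (Process.stuck-final (treeRule S)) spanning

  tree? : ∀ S → Dec (Tree S)
  tree? S = map′ (λ (a , i , c) → record { avoids-s = a ; injective = i ; spanning = c })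
    (λ t → Tree.avoids-s t , Tree.injective t , Tree.spanning t)
    (all? (λ e → (e ∈ˢ? S) →-dec ¬? (tgt e ≟ s)) ×-dec
     (all? (λ e → all? λ f → (e ∈ˢ? S) →-dec ((f ∈ˢ? S) →-dec ((tgt e ≟ tgt f) →-dec (e ≟ f)))) ×-dec
      all? (λ v → burnt? (treeRule S) (final (treeRule S)) v)))

  run-treeRule : ∀ {R L} → Run R L → Run (treeRule (ignitions R L)) L
  run-treeRule r = run-cong (agree-treeRule r) r

  final-ignitions : ∀ {R L} → Run R L → Complete L → final (treeRule (ignitions R L)) ≡ L
  final-ignitions {R} {L} r c = Process.final-complete (treeRule (ignitions R L)) (run-treeRule r) c

  ignitions-tree : ∀ {R L} → Run R L → Complete L → Spanning R L → Tree (ignitions R L)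
  ignitions-tree {R} {L} r c span = record
    { avoids-s = λ _ → Process.ignitions-avoid-s R L
    ; injective = λ _ _ → Process.ignitions-injective R L
    ; spanning = subst (Spanning (treeRule (ignitions R L))) (sym (final-ignitions r c))
        (λ v → to (agree-treeRule r) whole (span v))
    }

  -- Under the tree rule only a tree edge can ignite. Conversely each tree edge ignites its target,
  -- which is not `s` and which no other tree edge enters.
  tree-ignitions : ∀ {S} → Tree S → ignitions (treeRule S) (final (treeRule S)) ≡ S
  tree-ignitions {S} t = ⊆-antisym sub sup
    where
    open Process (treeRule S) using (∈-ignitions⁺; ∈-ignitions⁻; run-unique; run-final)
    sub : ∀ {e} → e ∈ˢ ignitions (treeRule S) (final (treeRule S)) → e ∈ˢ S
    sub e∈ with ∈-ignitions⁻ (final (treeRule S)) e∈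
    ... | _ , _ , ¬b , inj₁ p = contradiction (inj₁ p) ¬b
    ... | _ , _ , ¬b , inj₂ (_ , here refl , e∈S , _) = e∈S
    ... | _ , _ , ¬b , inj₂ (f , there f∈ , q) = contradiction (inj₂ (f , f∈ , q)) ¬b
    sup : ∀ {e} → e ∈ˢ S → e ∈ˢ ignitions (treeRule S) (final (treeRule S))
    sup {e} e∈S with ∈⇒⊑ (Tree.complete t e)
    ... | L′ , p = ∈-ignitions⁺ p (unburnt , inj₂ (e , here refl , e∈S , refl))
      where
      unburnt : ¬ Burnt (treeRule S) L′ (tgt e)
      unburnt (inj₁ eq) = Tree.avoids-s t e e∈S eq
      unburnt (inj₂ (f , f∈ , f∈S , eq)) with refl ← Tree.injective t f e f∈S e∈S eq =
        Unique[x∷xs]⇒x∉xs (⊑-unique p (run-unique run-final)) f∈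

-- Configurations as rules, and configurations read off from runs.

module Configurations (G : Digraph) (s : Fin (Digraph.n G)) (eulerian : Eulerian G) where
  open Digraph G
  open Sandpile G s
  open Burning G s
  open Rule using (Burnt; burnt?; sink; mono; local; initial)
  open Process using (Run; []; step; late; lateAt; ignitions; final)

  -- Stability is an argument because of `initial`: it keeps every non-sink vertex below its
  -- threshold before any edge is processed, the threshold being the indegree, hence the outdegree.
  configRule : ∀ c → Stable G s c → Rule
  configRule c st = record
    { Burnt   = Burntᶜ
    ; burnt?  = λ L v → (v ≟ s) ⊎-dec (indeg G v ≤? c at v + arrivals L v)
    ; sink    = inj₁ refl
    ; mono    = λ {e} {L} {v} → [ inj₁ , (λ le → inj₂ (≤-trans le (+-monoʳ-≤ (c at v) (arrivals-⊑ (later {y = e} whole) v)))) ]′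
    ; local   = local′
    ; initial = initial′
    }
    where
    Burntᶜ : Edges → Fin n → Set
    Burntᶜ L v = v ≡ s ⊎ indeg G v ≤ c at v + arrivals L v
    local′ : ∀ {e L v} → Burntᶜ (e ∷ L) v → ¬ Burntᶜ L v → tgt e ≡ v
    local′ (inj₁ p) ¬b = contradiction (inj₁ p) ¬b
    local′ {e} {L} {v} (inj₂ le) ¬b with tgt e ≟ v
    ... | yes eq = eq
    ... | no _   = contradiction (inj₂ le) ¬b
    initial′ : ∀ {v} → Burntᶜ [] v → v ≡ s
    initial′ (inj₁ p) = p
    initial′ {v} (inj₂ le) with v ≟ s
    ... | yes p = p
    ... | no v≢s = contradiction (subst₂ _≤_ (sym (eulerian v)) (+-identityʳ (c at v)) le) (<⇒≱ (st v v≢s))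

  -- After all edges have been processed, the arrivals alone meet every threshold.
  config-spanning : ∀ {c} st {L} → Run (configRule c st) L → Complete L → Spanning (configRule c st) L
  config-spanning {c} st r complete v = inj₂ (≤-trans (m≤n+m _ _)
    (≤-reflexive (cong (c at v +_) (sym (arrivals-complete (Process.run-unique (configRule c st) r) complete v)))))

  lateness : Rule → Edges → Config G
  lateness R L = tabulate λ v → if ⌊ v ≟ s ⌋ then 0 else lateAt R L v

  lateness-sink : ∀ R L → lateness R L at s ≡ 0
  lateness-sink R L = trans (lookup∘tabulate _ s) (if-yes (s ≟ s) refl)

  lateness-at : ∀ R L {v} → v ≢ s → lateness R L at v ≡ lateAt R L v
  lateness-at R L {v} v≢s = trans (lookup∘tabulate _ v) (if-no (v ≟ s) v≢s)

  lateness-cong : ∀ {R R′ L} → Agree R R′ L → lateness R L ≡ lateness R′ L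
  lateness-cong a = cong (λ es → tabulate λ v → if ⌊ v ≟ s ⌋ then 0 else count (λ e → tgt e ≟ v) es) (late-cong a)

  module _ {c : Config G} (st : Stable G s c) where
    private R = configRule c st
    open Process R using (lateAt-elsewhere; lateAt-burnt; lateAt-ignition; lateAt-unburnt; run-unique)

    -- Arrivals come one at a time, so at ignition the threshold is met with equality. Each later
    -- arrival at `v` is late and raises both sides by one.
    surplus : ∀ L {v} → v ≢ s → Burnt R L v → c at v + arrivals L v ≡ indeg G v + lateAt R L v
    surplus [] v≢s b = contradiction (initial R b) v≢s
    surplus (e ∷ L) {v} v≢s b with burnt? R L v
    ... | no ¬b with refl ← local R {e} {L} {v} b ¬b = begin
        c at v + arrivals (e ∷ L) v          ≡⟨ ≤-antisym below (above b) ⟩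
        indeg G v                            ≡⟨ +-identityʳ _ ⟨
        indeg G v + 0                        ≡⟨ cong (indeg G v +_) (trans (lateAt-ignition v L ¬b) (lateAt-unburnt L ¬b)) ⟨
        indeg G v + lateAt R (e ∷ L) v       ∎
      where
      open ≡-Reasoning
      below : c at v + arrivals (e ∷ L) v ≤ indeg G v
      below = subst (_≤ indeg G v)
        (sym (trans (cong (c at v +_) (count-accept (λ e → tgt e ≟ v) {x = e} refl L)) (+-suc (c at v) _)))
        (≰⇒> (λ le → ¬b (inj₂ le)))
      above : Burnt R (e ∷ L) v → indeg G v ≤ c at v + arrivals (e ∷ L) v
      above (inj₁ p)  = contradiction p v≢s
      above (inj₂ le) = le
    ... | yes bL with tgt e ≟ v
    ...   | no e≢v = trans (surplus L v≢s bL) (cong (indeg G v +_) (sym (lateAt-elsewhere L e≢v)))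
    ...   | yes refl = begin
        c at v + suc (arrivals L v)      ≡⟨ +-suc (c at v) _ ⟩
        suc (c at v + arrivals L v)      ≡⟨ cong suc (surplus L v≢s bL) ⟩
        suc (indeg G v + lateAt R L v)   ≡⟨ +-suc (indeg G v) _ ⟨
        indeg G v + suc (lateAt R L v)   ≡⟨ cong (indeg G v +_) (lateAt-burnt L bL) ⟨
        indeg G v + lateAt R (e ∷ L) v   ∎
      where open ≡-Reasoning

    lateness-config : ∀ {L} → SConfig G s c → Run R L → Complete L → lateness R L ≡ c
    lateness-config {L} c₀ r complete = lookup-ext eq
      where
      eq : ∀ v → lateness R L at v ≡ c at v
      eq v with v ≟ s
      ... | yes refl = trans (lateness-sink R L) (sym c₀)
      ... | no v≢s = trans (lateness-at R L v≢s) (+-cancelˡ-≡ (indeg G v) _ _ (begin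
        indeg G v + lateAt R L v   ≡⟨ surplus L v≢s (config-spanning st r complete v) ⟨
        c at v + arrivals L v      ≡⟨ cong (c at v +_) (arrivals-complete (run-unique r) complete v) ⟩
        c at v + indeg G v         ≡⟨ +-comm (c at v) _ ⟩
        indeg G v + c at v         ∎))
        where open ≡-Reasoning

    -- The order of ignition is a burning order: processed edges have burnt sources, so the arrivals
    -- that ignite a vertex all come from vertices listed before it.
    burn-order : ∀ {L} → Run R L → ∃ λ vs → BurnOrder c vs ×
      (∀ {v} → v ∈ vs → Burnt R L v) × (∀ {v} → Burnt R L v → v ∈ vs)
    burn-order [] = s ∷ [] , root , (λ { (here p) → inj₁ p }) , λ b → here (initial R b)
    burn-order (step {e} {L} r av max) with burn-order r | Process.ignites? R L e
    ... | vs , order , sound , complete | no ¬ig = vs , order , (λ p → mono R {e} {L} (sound p)) , complete′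
      where
      complete′ : ∀ {v} → Burnt R (e ∷ L) v → v ∈ vs
      complete′ {v} b with burnt? R L v
      ... | yes b′ = complete b′
      ... | no ¬b with refl ← local R {e} {L} {v} b ¬b = contradiction (¬b , b) ¬ig
    ... | vs , order , sound , complete | yes (¬b , b) =
      tgt e ∷ vs , burn order (λ p → ¬b (sound p)) (enough b) ,
      (λ { (here refl) → b ; (there p) → mono R {e} {L} (sound p) }) , complete′
      where
      complete′ : ∀ {v} → Burnt R (e ∷ L) v → v ∈ tgt e ∷ vs
      complete′ {v} b with burnt? R L v
      ... | yes b′ = there (complete b′)
      ... | no ¬b  = here (sym (local R {e} {L} {v} b ¬b))
      sources : ∀ {f} → f ∈ e ∷ L → src f ∈ vs
      sources (here refl) = complete (proj₂ av)
      sources (there f∈)  = complete (Process.run-src R r f∈)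
      enough : Burnt R (e ∷ L) (tgt e) → outdeg G (tgt e) ≤ c at tgt e + into (_∈? vs) (tgt e)
      enough (inj₁ p)  = contradiction (inj₁ p) ¬b
      enough (inj₂ le) = ≤-trans (≤-reflexive (eulerian (tgt e))) (≤-trans le (+-monoʳ-≤ (c at tgt e)
        (count-⊆ (λ f → tgt f ≟ tgt e) _ (run-unique (step r av max)) λ {f} f∈ p → ∈-allFin f , sources f∈ , p)))

    -- Otherwise the unburnt vertices form a set to which `Spreads` applies. The vertex `v` found
    -- there has enough chips for all edges from unburnt sources; edges from burnt sources have all
    -- been processed, as the run is stuck. Hence `v` meets its threshold.
    spreads⇒spanning : Spreads c → Spanning R (final R)
    spreads⇒spanning sp with any? (λ v → ¬? (burnt? R (final R) v))
    ... | no none = λ v → decidable-stable (burnt? R (final R) v) (λ ¬b → none (v , ¬b))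
    ... | yes some with sp {λ v → ¬ Burnt R (final R) v} (λ v → ¬? (burnt? R (final R) v)) (λ ¬b → ¬b (inj₁ refl)) some
    ...   | v , ¬b , le = contradiction (inj₂ (begin
        indeg G v                                  ≡⟨ count-⊎ _ _ _ split proj₂ proj₂ (λ (p , _) (q , _) → q p) (allFin m) ⟩
        into (burnt? R (final R)) v + into unburnt? v ≤⟨ +-mono-≤ processed le ⟩
        arrivals (final R) v + c at v              ≡⟨ +-comm (arrivals (final R) v) _ ⟩
        c at v + arrivals (final R) v              ∎)) ¬b
      where
      open ≤-Reasoning
      unburnt? : Decidable (λ v → ¬ Burnt R (final R) v)
      unburnt? v = ¬? (burnt? R (final R) v)
      split : ∀ {e} → tgt e ≡ v → (Burnt R (final R) (src e) × tgt e ≡ v) ⊎ (¬ Burnt R (final R) (src e) × tgt e ≡ v)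
      split {e} p with burnt? R (final R) (src e)
      ... | yes b = inj₁ (b , p)
      ... | no ¬b = inj₂ (¬b , p)
      processed : into (burnt? R (final R)) v ≤ arrivals (final R) v
      processed = count-⊆ _ _ (allFin⁺ m) λ {e} _ (b , p) →
        decidable-stable (mem? _≟_ e (final R)) (λ e∉ → Process.stuck-final R e (e∉ , b)) , p

  -- The configuration given by the late edges of a complete run.

  module _ {R : Rule} {L : Edges} (r : Run R L) (complete : Complete L) where
    open Process R using (after-burning; before-burning; run-unique)

    dlvl-lateness : dlvl G s (lateness R L) ≡ length (late R L)
    dlvl-lateness = begin
      outdeg G s + sum (map (λ v → if ⌊ v ≟ s ⌋ then 0 else lateness R L at v) (allFin n))
        ≡⟨ cong₂ _+_ at-s (elsewhere (allFin⁺ n)) ⟩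
      count (λ e → tgt e ≟ s) es + count (λ e → (tgt e ∈? allFin n) ×-dec ¬? (tgt e ≟ s)) es
        ≡⟨ count-⊎ {P = λ _ → ⊤} (λ _ → yes tt) _ _ (λ {e} _ → split e) (λ _ → tt) (λ _ → tt) (λ p (_ , ¬p) → ¬p p) es ⟨
      count {P = λ _ → ⊤} (λ _ → yes tt) es
        ≡⟨ count-all (λ _ → yes tt) tt es ⟩
      length es ∎
      where
      open ≡-Reasoning
      es = late R L
      split : ∀ e → tgt e ≡ s ⊎ (tgt e ∈ allFin n × tgt e ≢ s)
      split e with tgt e ≟ s
      ... | yes p = inj₁ p
      ... | no ¬p = inj₂ (∈-allFin (tgt e) , ¬p)
      -- The sink burns from the start, so every edge into it is late. The term deg⁺(s) of the
      -- d-level accounts for these edges, as the entry of a configuration at `s` is 0.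
      at-s : outdeg G s ≡ lateAt R L s
      at-s = begin
        outdeg G s       ≡⟨ eulerian s ⟩
        indeg G s        ≡⟨ arrivals-complete (run-unique r) complete s ⟨
        arrivals L s     ≡⟨ after-burning ([]⊑ L) (sink R) ⟨
        lateAt R L s + 0 ≡⟨ +-identityʳ _ ⟩
        lateAt R L s     ∎
      elsewhere : ∀ {vs} → Unique vs → sum (map (λ v → if ⌊ v ≟ s ⌋ then 0 else lateness R L at v) vs)
        ≡ count (λ e → (tgt e ∈? vs) ×-dec ¬? (tgt e ≟ s)) es
      elsewhere [] = sym (count-none _ (λ { (() , _) }) es)
      elsewhere {v ∷ vs} (v∉ ∷ u) with v ≟ s
      ... | yes refl = trans (elsewhere u) (count-cong _ _ (λ (p , q) → there p , q)
        (λ { (here p , q) → contradiction p q ; (there p , q) → p , q }) es)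
      ... | no v≢s = trans (cong₂ _+_ (lateness-at R L v≢s) (elsewhere u)) (sym (count-⊎ _ _ _
        (λ { (here p , _) → inj₁ p ; (there p , q) → inj₂ (p , q) })
        (λ { refl → here refl , v≢s }) (λ (p , q) → there p , q)
        (λ { refl (p , _) → All-lookup v∉ p refl }) es))

    module _ (spanning : Spanning R L) where

      -- At the empty stage this yields stability; at any stage it keeps an unburnt vertex below its
      -- threshold when late edges are read as chips.
      lateAt-bound : ∀ {L′ v} → L′ ⊑ L → ¬ Burnt R L′ v → lateAt R L v + arrivals L′ v < indeg G v
      lateAt-bound {L′} {v} p ¬b = subst (lateAt R L v + arrivals L′ v <_)
        (arrivals-complete (run-unique r) complete v) (before-burning p ¬b (spanning v))

      lateness-stable : Stable G s (lateness R L)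
      lateness-stable v v≢s = begin-strict
        lateness R L at v   ≡⟨ lateness-at R L v≢s ⟩
        lateAt R L v        ≡⟨ +-identityʳ _ ⟨
        lateAt R L v + 0    <⟨ lateAt-bound ([]⊑ L) (λ b → v≢s (initial R b)) ⟩
        indeg G v           ≡⟨ eulerian v ⟨
        outdeg G v          ∎
        where open ≤-Reasoning

      -- For a burnt vertex the late edges, read as chips, supply at least the arrivals still
      -- missing (`after-burning`); an unburnt one stays short of the threshold (`lateAt-bound`).
      agree-configRule : ∀ st → Agree R (configRule (lateness R L) st) L
      agree-configRule st = record { to = to′ ; from = from′ }
        where
        to′ : ∀ {L′ v} → L′ ⊑ L → Burnt R L′ v → Burnt (configRule (lateness R L) st) L′ v
        to′ {L′} {v} p b with v ≟ s
        ... | yes eq = inj₁ eq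
        ... | no v≢s = inj₂ (begin
          indeg G v                           ≡⟨ arrivals-complete (run-unique r) complete v ⟨
          arrivals L v                        ≤⟨ m≤n+m _ _ ⟩
          lateAt R L′ v + arrivals L v        ≡⟨ after-burning p b ⟨
          lateAt R L v + arrivals L′ v        ≡⟨ cong (_+ arrivals L′ v) (lateness-at R L v≢s) ⟨
          lateness R L at v + arrivals L′ v   ∎)
          where open ≤-Reasoning
        from′ : ∀ {L′ v} → L′ ⊑ L → Burnt (configRule (lateness R L) st) L′ v → Burnt R L′ v
        from′ p (inj₁ refl) = sink R
        from′ {L′} {v} p (inj₂ le) with v ≟ s | burnt? R L′ v
        ... | yes refl | _    = sink R
        ... | no _ | yes b    = b
        ... | no v≢s | no ¬b  = contradiction
          (subst (λ k → indeg G v ≤ k + arrivals L′ v) (lateness-at R L v≢s) le) (<⇒≱ (lateAt-bound p ¬b))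

-- Walks and their uniqueness in a tree.

module Walks (G : Digraph) where
  open Digraph G

  verts-map : ∀ u es → verts G u es ≡ u ∷ map tgt es
  verts-map u []       = refl
  verts-map u (e ∷ es) = cong (u ∷_) (verts-map (tgt e) es)

  tailV-map : ∀ u es → tailV G u es ≡ map tgt es
  tailV-map u []       = refl
  tailV-map u (e ∷ es) = verts-map (tgt e) es

  walk-++ : ∀ {u v w xs ys} → IsWalk G u xs v → IsWalk G v ys w → IsWalk G u (xs ++ ys) w
  walk-++ nil q        = q
  walk-++ (cons p w) q = cons p (walk-++ w q)

  walk-edge : ∀ e → IsWalk G (src e) (e ∷ []) (tgt e)
  walk-edge e = cons refl nil

  walk-split : ∀ xs {ys u w} → IsWalk G u (xs ++ ys) w → ∃ λ v → IsWalk G u xs v × IsWalk G v ys w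
  walk-split [] q = _ , nil , q
  walk-split (x ∷ xs) (cons p q) = let v , a , b = walk-split xs q in v , cons p a , b

  walk-end : ∀ {u v w xs} → IsWalk G u xs v → IsWalk G u xs w → v ≡ w
  walk-end nil nil               = refl
  walk-end (cons _ p) (cons _ q) = walk-end p q

  walk-∷ʳ : ∀ xs {x u v} → IsWalk G u (xs ++ x ∷ []) v → IsWalk G u xs (src x) × tgt x ≡ v
  walk-∷ʳ xs q with walk-split xs q
  ... | _ , a , cons refl nil = a , refl

  walk-around : ∀ xs {x ys u w} → IsWalk G u (xs ++ x ∷ ys) w → IsWalk G u xs (src x) × IsWalk G (tgt x) ys w
  walk-around xs q with walk-split xs q
  ... | _ , a , cons refl b = a , b

  unique-verts-suffix : ∀ {u v xs ys} → IsWalk G u xs v → Unique (verts G u (xs ++ ys)) → Unique (verts G v ys)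
  unique-verts-suffix nil un              = un
  unique-verts-suffix (cons _ w) (_ ∷ un) = unique-verts-suffix w un

  unique-∷ʳ : {A : Set} {xs : List A} {y : A} → Unique xs → y ∉ xs → Unique (xs ++ y ∷ [])
  unique-∷ʳ u y∉ = Unique-++⁺ u ([] ∷ []) λ { (p , here refl) → y∉ p }

  Diverge : List (Fin m) → List (Fin m) → Set
  Diverge xs ys = ∀ {z as bs} → xs ≡ z ∷ as → ¬ ys ≡ z ∷ bs

  diverge : ∀ xs ys → ∃ λ zs → ∃ λ as → ∃ λ bs → xs ≡ zs ++ as × ys ≡ zs ++ bs × Diverge as bs
  diverge [] ys = [] , [] , ys , refl , refl , λ ()
  diverge (x ∷ xs) [] = [] , x ∷ xs , [] , refl , refl , λ _ ()
  diverge (x ∷ xs) (y ∷ ys) with x ≟ y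
  ... | no x≢y = [] , x ∷ xs , y ∷ ys , refl , refl , λ { refl refl → x≢y refl }
  ... | yes refl with diverge xs ys
  ...   | zs , as , bs , p , q , d = x ∷ zs , as , bs , cong (x ∷_) p , cong (x ∷_) q , d

  diverge-common : ∀ zs {x as bs} → ¬ Diverge (zs ++ x ∷ as) (zs ++ x ∷ bs)
  diverge-common [] d      = d refl refl
  diverge-common (_ ∷ _) d = d refl refl

  -- The vertices entered by a path are distinct, so an edge of the path
  -- leading to its end vertex is its last edge.
  last-edge : ∀ {u es} e → IsWalk G u es (tgt e) → Unique (map tgt es) → e ∈ es →
    ∃ λ xs → es ≡ xs ++ e ∷ [] × e ∉ xs
  last-edge e (cons _ nil) un (here refl) = [] , refl , λ ()
  last-edge e (cons _ w@(cons _ _)) (x∉ ∷ un) (here refl) = contradiction (end∈ w) (λ p → All-lookup x∉ p refl)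
    where
    end∈ : ∀ {u x xs v} → IsWalk G u (x ∷ xs) v → v ∈ map tgt (x ∷ xs)
    end∈ (cons _ nil)          = here refl
    end∈ (cons _ w@(cons _ _)) = there (end∈ w)
  last-edge e (cons {e = x} _ w) (x∉ ∷ un) (there e∈) with last-edge e w un e∈
  ... | xs , refl , e∉ = x ∷ xs , refl , λ { (here refl) → All-lookup x∉ (∈-map⁺ tgt e∈) refl ; (there p) → e∉ p }

  module _ (s : Fin n) {S : Subset m}
    (avoids-s : ∀ e → e ∈ˢ S → tgt e ≢ s)
    (injective : ∀ e f → e ∈ˢ S → f ∈ˢ S → tgt e ≡ tgt f → e ≡ f) where

    -- Read from its end, a walk from `s` is forced: at most one edge of `S` enters each vertex and
    -- none enters `s`, so the way back has no choice and stops only at `s`.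
    walk-unique : ∀ {es fs v} → IsWalk G s es v → IsWalk G s fs v →
      All (InT G S) es → All (InT G S) fs → es ≡ fs
    walk-unique {es} {fs} p q = go (reverseView es) (reverseView fs) p q
      where
      go : ∀ {es fs v} → Reverse es → Reverse fs → IsWalk G s es v → IsWalk G s fs v →
        All (InT G S) es → All (InT G S) fs → es ≡ fs
      go [] [] _ _ _ _ = refl
      go [] (fs ∶ _ ∶ʳ f) nil q _ b = contradiction (proj₂ (walk-∷ʳ fs q)) (avoids-s f (All-lookup b (∈-++⁺ʳ fs (here refl))))
      go (es ∶ _ ∶ʳ e) [] p nil a _ = contradiction (proj₂ (walk-∷ʳ es p)) (avoids-s e (All-lookup a (∈-++⁺ʳ es (here refl))))
      go (es ∶ re ∶ʳ e) (fs ∶ rf ∶ʳ f) p q a b with walk-∷ʳ es p | walk-∷ʳ fs q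
      ... | p′ , e≡ | q′ , f≡ with injective e f (All-lookup a (∈-++⁺ʳ es (here refl))) (All-lookup b (∈-++⁺ʳ fs (here refl))) (trans e≡ (sym f≡))
      ...   | refl = cong (_++ e ∷ []) (go re rf p′ q′ (All-++⁻ˡ es a) (All-++⁻ˡ fs b))

-- Arborescences are the trees of the burning process.

module Arborescences (G : Digraph) (s : Fin (Digraph.n G)) where
  open Digraph G
  open Walks G
  open Burning G s
  open Rule using (Burnt; burnt?)
  open Process using (Run; []; step; late; final)

  module _ (S : Subset m) where
    private R = treeRule S

    -- Keeping the edges inside stage `L` guarantees that a vertex unburnt at `L` is not on the
    -- path, so the path can be extended to it.
    Within : Edges → Fin n → Edges → Fin n → Set
    Within L u es v = IsPath G (InT G S) u es v × (∀ {e} → e ∈ es → e ∈ L)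

    extend-path : ∀ {L e es} → e ∈ˢ S → ¬ Burnt R L (tgt e) → Within L s es (src e) → Within (e ∷ L) s (es ++ e ∷ []) (tgt e)
    extend-path {L} {e} {es} e∈S ¬b ((w , a , un) , es⊆L) =
      (walk-++ w (walk-edge e) , All-++⁺ a (e∈S ∷ []) , subst Unique verts-∷ʳ (unique-∷ʳ un fresh)) ,
      λ f∈ → [ (λ p → there (es⊆L p)) , (λ { (here p) → here p }) ]′ (∈-++⁻ es f∈)
      where
      open ≡-Reasoning
      verts-∷ʳ : verts G s es ++ tgt e ∷ [] ≡ verts G s (es ++ e ∷ [])
      verts-∷ʳ = begin
        verts G s es ++ tgt e ∷ []     ≡⟨ cong (_++ tgt e ∷ []) (verts-map s es) ⟩
        s ∷ map tgt es ++ tgt e ∷ []   ≡⟨ cong (s ∷_) (map-++ tgt es (e ∷ [])) ⟨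
        s ∷ map tgt (es ++ e ∷ [])     ≡⟨ verts-map s (es ++ e ∷ []) ⟨
        verts G s (es ++ e ∷ [])       ∎
      fresh : tgt e ∉ verts G s es
      fresh p with subst (tgt e ∈_) (verts-map s es) p
      ... | here eq = ¬b (inj₁ eq)
      ... | there q with ∈-map⁻ tgt q
      ...   | f , f∈ , eq = ¬b (inj₂ (f , es⊆L f∈ , All-lookup a f∈ , sym eq))

    burnt-path : ∀ {L v} → Run R L → Burnt R L v → ∃ λ es → Within L s es v
    burnt-path [] (inj₁ refl) = [] , (nil , [] , [] ∷ []) , λ ()
    burnt-path {e ∷ L} {v} (step r (_ , bsrc) _) b with burnt? R L v
    ... | yes b′ = let es , p , sub = burnt-path r b′ in es , p , λ e∈ → there (sub e∈)
    ... | no ¬b with b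
    ...   | inj₁ p = contradiction (inj₁ p) ¬b
    ...   | inj₂ (f , there f∈ , q) = contradiction (inj₂ (f , f∈ , q)) ¬b
    ...   | inj₂ (_ , here refl , e∈S , refl) = let es , p = burnt-path r bsrc in es ++ e ∷ [] , extend-path e∈S ¬b p

    -- Fire runs forwards along a tree walk. The first hypothesis is met when the run is stuck, and
    -- also at the stage before the least edge of two paths is processed, for the path avoiding that
    -- edge.
    flows : ∀ {L u v es} → (∀ {e} → e ∈ es → Burnt R L (src e) → e ∈ L) →
      IsWalk G u es v → All (InT G S) es → Burnt R L u → Burnt R L v
    flows proc nil [] b = b
    flows proc (cons {e = e} refl w) (e∈S ∷ a) b =
      flows (λ p → proc (there p)) w a (inj₂ (e , proc (here refl) b , e∈S , refl))

    arborescence⇒tree : Arborescence G s S → Tree S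
    arborescence⇒tree (reach , unique , ends) = record
      { avoids-s = avoids
      ; injective = λ e f e∈ f∈ eq → inj e f e∈ f∈ eq
      ; spanning = λ v → let es , w , a , _ = reach v in flows processed w a (inj₁ refl)
      }
      where
      avoids : ∀ e → e ∈ˢ S → tgt e ≢ s
      avoids e e∈S eq with ends e e∈S
      -- The empty path already leads to `s`, so a path ending in `e` would be a second one. The
      -- case split exposes that `es ++ [ e ]` is nonempty.
      ... | [] , p with () ← unique (tgt e) _ [] p (subst (λ v → IsWalk G s [] v) (sym eq) nil , [] , [] ∷ [])
      ... | _ ∷ _ , p with () ← unique (tgt e) _ [] p (subst (λ v → IsWalk G s [] v) (sym eq) nil , [] , [] ∷ [])
      inj : ∀ e f → e ∈ˢ S → f ∈ˢ S → tgt e ≡ tgt f → e ≡ f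
      inj e f e∈S f∈S eq with ends e e∈S | ends f f∈S
      ... | es , p | fs , q = ∷ʳ-injectiveʳ es fs (unique (tgt e) _ _ p (subst (IsPath G (InT G S) s _) (sym eq) q))
      processed : ∀ {e} {es : Edges} → e ∈ es → Burnt R (final R) (src e) → e ∈ final R
      processed {e} _ b = decidable-stable (mem? _≟_ e (final R)) λ e∉ → Process.stuck-final R e (e∉ , b)

    module _ (t : Tree S) where
      open Tree t
      open Process R using (run-final; run-⊑; run-unique; run-src; mono*)

      -- The target is not `s`, and `e` is the only tree edge into it, so nothing else can have
      -- ignited it.
      tree-burnt : ∀ {L e} → e ∈ˢ S → Burnt R L (tgt e) → e ∈ L
      tree-burnt {e = e} e∈S (inj₁ eq) = contradiction eq (avoids-s e e∈S)
      tree-burnt {e = e} e∈S (inj₂ (f , f∈ , f∈S , eq)) with refl ← injective f e f∈S e∈S eq = f∈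

      tree⇒arborescence : Arborescence G s S
      tree⇒arborescence =
        (λ v → let es , p , _ = burnt-path run-final (spanning v) in es , p) ,
        (λ v es fs (p , a , _) (q , b , _) → walk-unique s avoids-s injective p q a b) ,
        ends
        where
        ends : ∀ e → e ∈ˢ S → ∃ λ es → IsPath G (InT G S) s (es ++ e ∷ []) (tgt e)
        ends e e∈S with ∈⇒⊑ (complete e)
        ... | L , p with run-⊑ p run-final
        ...   | step r (e∉ , b) _ = let es , q = burnt-path r b in
          es , proj₁ (extend-path e∈S (λ b → e∉ (tree-burnt e∈S b)) q)

      -- External activity equals lateness.

      -- The converse of `flows`: a burnt vertex was ignited through its tree edge, whose source
      -- must have burnt before; repeat back to the start of the walk.
      drains : ∀ {L u v es} → Run R L → IsWalk G u es v → All (InT G S) es → Burnt R L v → Burnt R L u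
      drains r nil [] b = b
      drains r (cons refl w) (e∈S ∷ a) b = run-src r (tree-burnt e∈S (drains r w a b))

      -- The edge `f` was the greatest available one at stage `L`, so a larger edge with burnt
      -- source can only have been processed already.
      greedy : ∀ {f L g} → Run R (f ∷ L) → f ≤ᶠ g → g ≢ f → Burnt R L (src g) → g ∈ L
      greedy {f} {L} {g} (step _ _ max) f≤g g≢f b =
        decidable-stable (mem? _≟_ g L) λ g∉ → g≢f (≤ᶠ-antisym (max (g∉ , b)) f≤g)

      late-edge : ∀ {L e} → L ⊑ final R → e ∉ L → Burnt R L (tgt e) → e ∈ late R (final R)
      late-edge {e = e} p e∉ b with ∈⇒⊑ (complete e)
      ... | _ , q = ∈-select⁺ _ q (mono* (⊑-∉ q p e∉) b)

      -- Up to the moment when the least edge f of the two paths is processed,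
      -- the path that avoids f always offers a larger edge, so it is completed before f.
      active⇒late : ∀ {e} → ExternallyActive G S e → e ∈ late R (final R)
      active⇒late {e} (e∉S , u , P₁ , P₂ , (w₁ , h₁ , un₁) , (w₂ , h₂ , un₂) , disj , e∈P₁ , f , f∈P₁ , min)
        with last-edge e w₁ (entered un₁) e∈P₁ | ∈⇒⊑ (complete f)
        where
        entered : Unique (verts G u P₁) ⊎ (u ≡ tgt e × Unique (tailV G u P₁)) → Unique (map tgt P₁)
        entered (inj₁ un) with subst Unique (verts-map u P₁) un
        ... | _ ∷ un′ = un′
        entered (inj₂ (_ , un)) = subst Unique (tailV-map u P₁) un
      ... | Q , refl , e∉Q | L , p = late-edge (⊑-tail p) (proj₂ (before (∈-++⁻ Q f∈P₁)))
          (flows (λ g∈ → greedy rf (min _ (∈-++⁺ʳ P₁ g∈)) (λ { refl → disj _ f∈P₁ g∈ })) w₂ P₂⊆S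
            (proj₁ (before (∈-++⁻ Q f∈P₁))))
        where
        rf : Run R (f ∷ L)
        rf = run-⊑ p run-final
        r : Run R L
        r = run-⊑ (later whole) rf
        f∉L : f ∉ L
        f∉L = Unique[x∷xs]⇒x∉xs (run-unique rf)
        f-burnt : Run R (f ∷ L) → Burnt R L (src f)
        f-burnt (step _ (_ , b) _) = b
        drop-e : ∀ {es} → All (InT+ G S e) es → e ∉ es → All (InT G S) es
        drop-e h e∉ = All-tabulate λ g∈ → [ (λ q → q) , (λ { refl → contradiction g∈ e∉ }) ]′ (All-lookup h g∈)
        P₂⊆S : All (InT G S) P₂
        P₂⊆S = drop-e h₂ (disj e e∈P₁)
        Q⊆S : All (InT G S) Q
        Q⊆S = drop-e (All-++⁻ˡ Q h₁) e∉Q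
        wQ : IsWalk G u Q (src e)
        wQ = proj₁ (walk-∷ʳ Q w₁)
        -- Tracing the fire back from the source of `f` shows that `u` is burnt. If `f` precedes `e`
        -- on the path and `e` were processed, tracing back from the source of `e` would show that
        -- `f` had been processed too.
        before : f ∈ Q ⊎ f ∈ (e ∷ []) → Burnt R L u × e ∉ L
        before (inj₂ (here refl)) = drains r wQ Q⊆S (f-burnt rf) , f∉L
        before (inj₁ f∈Q) with ∈-∃++ f∈Q
        ... | as , bs , refl with walk-around as wQ | All-++⁻ʳ as Q⊆S
        ...   | wa , wb | f∈S ∷ bs⊆S =
          drains r wa (All-++⁻ˡ as Q⊆S) (f-burnt rf) ,
          λ e∈L → f∉L (tree-burnt f∈S (drains r wb bs⊆S (run-src r e∈L)))

      -- Take the tree paths from `s` to the source and to the target of `e` and remove their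
      -- longest common prefix, which ends at `u`. The remainders are `as` and `bs`; the required
      -- paths are `as` followed by `e`, and `bs`.
      late⇒active : ∀ {e} → e ∈ late R (final R) → ExternallyActive G S e
      late⇒active {e} e∈late with ∈-select⁻ _ e∈late
      ... | L₀ , p₀ , b₀ with burnt-path run-final (spanning (src e)) | burnt-path run-final (spanning (tgt e))
      ... | ps , (wp , ap , up) , _ | qs , (wq , aq , uq) , _ with diverge ps qs
      ... | zs , as , bs , refl , refl , d with walk-split zs wp | walk-split zs wq
      ... | u , wz , wa | _ , wz′ , wb′ =
        e∉S , u , as ++ e ∷ [] , bs ,
        (walk-++ wa (walk-edge e) , All-++⁺ (All-map inj₁ as⊆S) (inj₂ refl ∷ []) , distinct (tgt e ≟ u)) ,
        (wb , All-map inj₁ bs⊆S , inj₁ (unique-verts-suffix wz uq)) ,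
        disj , e∈P₁ , f , [ (λ q → q) , (λ q → contradiction q f∉bs) ]′ (∈-++⁻ (as ++ e ∷ []) f∈) , min
        where
        wb : IsWalk G u bs (tgt e)
        wb = subst (λ x → IsWalk G x bs (tgt e)) (walk-end wz′ wz) wb′
        zs⊆S = All-++⁻ˡ zs ap
        as⊆S = All-++⁻ʳ zs ap
        bs⊆S = All-++⁻ʳ zs aq
        e∉S : e ∉ˢ S
        e∉S e∈S = Unique[x∷xs]⇒x∉xs (run-unique (run-⊑ p₀ run-final)) (tree-burnt e∈S b₀)
        from-u : ∀ {es fs v} → IsWalk G u es v → IsWalk G u fs v → All (InT G S) es → All (InT G S) fs → es ≡ fs
        from-u p q a b = ++-cancelˡ zs _ _ (walk-unique s avoids-s injective
          (walk-++ wz p) (walk-++ wz q) (All-++⁺ zs⊆S a) (All-++⁺ zs⊆S b))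
        upto : ∀ {es x v} → IsWalk G u es v → All (InT G S) es → x ∈ es →
          ∃ λ xs → ∃ λ ys → es ≡ xs ++ x ∷ ys × IsWalk G u (xs ++ x ∷ []) (tgt x) × All (InT G S) (xs ++ x ∷ [])
        upto w a x∈ with ∈-∃++ x∈
        ... | xs , ys , refl with walk-around xs w | All-++⁻ʳ xs a
        ...   | w′ , _ | x∈S ∷ _ = xs , ys , refl , walk-++ w′ (walk-edge _) , All-++⁺ (All-++⁻ˡ xs a) (x∈S ∷ [])
        -- If `as` passed through the target of `e`, its part up to there would be the tree walk
        -- `bs`, and the two remainders would share their first edge.
        tgt-e∉as : tgt e ∉ map tgt as
        tgt-e∉as p with ∈-map⁻ tgt p
        ... | x , x∈ , eq with upto wa as⊆S x∈
        ...   | xs , ys , as≡ , w , a = diverge-common xs (subst₂ Diverge as≡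
          (from-u wb (subst (IsWalk G u _) (sym eq) w) bs⊆S a) d)
        disj : ∀ x → x ∈ as ++ e ∷ [] → ¬ x ∈ bs
        disj x x∈ x∈bs with ∈-++⁻ as x∈
        ... | inj₂ (here refl) = e∉S (All-lookup bs⊆S x∈bs)
        ... | inj₁ x∈as with upto wa as⊆S x∈as | upto wb bs⊆S x∈bs
        ...   | xs , _ , as≡ , w , a | xs′ , _ , bs≡ , w′ , a′
          with refl ← ∷ʳ-injectiveˡ xs xs′ (from-u w w′ a a′) = diverge-common xs (subst₂ Diverge as≡ bs≡ d)
        as-unique : Unique (u ∷ map tgt as)
        as-unique = subst Unique (verts-map u as) (unique-verts-suffix wz up)
        tails : Unique (map tgt (as ++ e ∷ []))
        tails with as-unique
        ... | _ ∷ un = subst Unique (sym (map-++ tgt as (e ∷ []))) (unique-∷ʳ un tgt-e∉as)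
        -- If `e` leads back to `u`, the first path is closed, as for a loop; the second alternative
        -- of `IsPath⁰` covers this.
        distinct : Dec (tgt e ≡ u) → Unique (verts G u (as ++ e ∷ [])) ⊎ (u ≡ tgt e × Unique (tailV G u (as ++ e ∷ [])))
        distinct (yes eq) = inj₂ (sym eq , subst Unique (sym (tailV-map u _)) tails)
        distinct (no neq) = inj₁ (subst Unique (sym (trans (verts-map u _) (cong (u ∷_) (map-++ tgt as (e ∷ [])))))
          (unique-∷ʳ as-unique λ { (here eq) → neq eq ; (there p) → tgt-e∉as p }))
        e∈P₁ : e ∈ as ++ e ∷ []
        e∈P₁ = ∈-++⁺ʳ as (here refl)
        smallest = least (∈-++⁺ˡ {ys = bs} e∈P₁)
        f = proj₁ smallest
        f∈ = proj₁ (proj₂ smallest)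
        min = proj₂ (proj₂ smallest)
        -- Suppose the smallest edge `f` lies on `bs`, and let `L` be the stage before it is
        -- processed. Fire traced back from the source of `f` reaches `u`, and by greed all of the
        -- first path, `e` included, has been processed. Since `e` is late, its target burnt before
        -- that; tracing back along `bs` then shows `f` processed, a contradiction.
        f∉bs : f ∉ bs
        f∉bs f∈bs with ∈-∃++ f∈bs | ∈⇒⊑ (complete f)
        ... | xs , ys , bs≡ | L , p with run-⊑ p run-final
        ...   | rf@(step r (f∉L , f-burnt) _) with walk-around xs (subst (λ es → IsWalk G u es (tgt e)) bs≡ wb)
        ...     | wx , wy with subst (All (InT G S)) bs≡ bs⊆S
        ...       | a with All-++⁻ʳ xs a
        ...         | f∈S ∷ ys⊆S = f∉L (tree-burnt f∈S (drains r wy ys⊆S tgt-e-burnt))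
          where
          ahead : ∀ {g} → g ∈ as ++ e ∷ [] → Burnt R L (src g) → g ∈ L
          ahead g∈ = greedy rf (min _ (∈-++⁺ˡ g∈)) λ { refl → disj _ g∈ f∈bs }
          e∈L : e ∈ L
          e∈L = ahead e∈P₁ (flows (λ g∈ → ahead (∈-++⁺ˡ g∈)) wa as⊆S (drains r wx (All-++⁻ˡ xs a) f-burnt))
          tgt-e-burnt : Burnt R L (tgt e)
          tgt-e-burnt = mono* (⊑-tail (⊑-∋ (run-unique run-final) p₀ (⊑-tail p) e∈L)) b₀

      activity : ExtActivity G S (length (late R (final R)))
      activity = list⇒HasSize (select-unique _ (run-unique run-final)) late⇒active active⇒late

-- The bijection and the equality of coefficients.

module Correspondence (G : Digraph) (s : Fin (Digraph.n G)) (eulerian : Eulerian G) where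
  open Digraph G
  open Sandpile G s
  open Burning G s
  open Configurations G s eulerian
  open Arborescences G s
  open Process using (Run; late; ignitions; final; run-final; stuck-final; stuck⇒complete; final-complete)

  decode : Subset m → Config G
  decode S = lateness (treeRule S) (final (treeRule S))

  level : Subset m → ℕ
  level S = length (late (treeRule S) (final (treeRule S)))

  encode : ∀ c → Stable G s c → Subset m
  encode c st = ignitions (configRule c st) (final (configRule c st))

  module _ {S : Subset m} (t : Tree S) where
    open Tree t

    private
      r = run-final (treeRule S)

    decode-stable : Stable G s (decode S)
    decode-stable = lateness-stable r complete spanning

    decode-agree : ∀ st → Agree (treeRule S) (configRule (decode S) st) (final (treeRule S))
    decode-agree = agree-configRule r complete spanning

    decode-run : ∀ st → Run (configRule (decode S) st) (final (treeRule S))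
    decode-run st = run-cong (decode-agree st) r

    -- `c` is kept apart from `decode S` so that one stability proof serves two trees with the same
    -- configuration, as injectivity requires.
    encode-decode : ∀ {c} st → c ≡ decode S → encode c st ≡ S
    encode-decode st refl = begin
      ignitions (configRule c st) (final (configRule c st)) ≡⟨ cong (ignitions (configRule c st)) (final-complete (configRule c st) (decode-run st) complete) ⟩
      ignitions (configRule c st) (final (treeRule S))      ≡⟨ ignitions-cong (decode-agree st) ⟨
      ignitions (treeRule S) (final (treeRule S))           ≡⟨ tree-ignitions t ⟩
      S                                                     ∎
      where
      open ≡-Reasoning
      c = decode S

    dlvl-decode : dlvl G s (decode S) ≡ level S
    dlvl-decode = dlvl-lateness r complete

    private
      order = burn-order decode-stable (decode-run decode-stable)

    -- The run of the tree is also the run of its configuration, so its order of ignition is a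
    -- burning order through all vertices.
    open Absorption eulerian (lateness-sink (treeRule S) (final (treeRule S))) decode-stable (proj₁ (proj₂ order))
      (λ v → proj₂ (proj₂ (proj₂ order)) (config-spanning decode-stable (decode-run decode-stable) complete v))
      using () renaming (recurrent to decode-recurrent; ∼-reflexive to decode-∼; ∼⇒≡ to decode-∼⇒≡) public

    decode-level : ClassLevel G s (decode S) (level S)
    decode-level = (decode S , decode-recurrent , decode-∼ , dlvl-decode) ,
      λ d _ c∼d → ≤-reflexive (trans (cong (dlvl G s) (sym (decode-∼⇒≡ c∼d))) dlvl-decode)

    decode-level-unique : ∀ {ℓ} → ClassLevel G s (decode S) ℓ → level S ≡ ℓ
    decode-level-unique ((d , _ , c∼d , eq) , _) =
      trans (sym dlvl-decode) (trans (cong (dlvl G s) (decode-∼⇒≡ c∼d)) eq)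

  recurrent⇒decode : ∀ {c} → Recurrent G s c → ∃ λ S → Tree S × decode S ≡ c
  recurrent⇒decode {c} rec@(c₀ , _) = encode c st , ignitions-tree r complete spanning , (begin
    lateness (treeRule S) (final (treeRule S)) ≡⟨ cong (lateness (treeRule S)) (final-ignitions r complete) ⟩
    lateness (treeRule S) (final R)            ≡⟨ lateness-cong (agree-treeRule r) ⟨
    lateness R (final R)                       ≡⟨ lateness-config st c₀ r complete ⟩
    c                                          ∎)
    where
    open ≡-Reasoning
    st = recurrent⇒stable rec
    R = configRule c st
    S = encode c st
    r = run-final R
    spanning : Spanning R (final R)
    spanning = spreads⇒spanning st (recurrent⇒spreads eulerian rec)
    complete : Complete (final R)
    complete = stuck⇒complete R (stuck-final R) spanning

  module _ (ℓ : ℕ) where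

    TreeOfLevel : Subset m → Set
    TreeOfLevel S = Tree S × level S ≡ ℓ

    treeOfLevel? : Decidable TreeOfLevel
    treeOfLevel? S = tree? S ×-dec (level S ≟ⁿ ℓ)

    -- This one list indexes both sides, the arborescences directly and the classes through
    -- `decode`; its length is the common coefficient.
    trees : List (Subset m)
    trees = filter treeOfLevel? (subsets m)

    trees-unique : Unique trees
    trees-unique = Unique-filter⁺ treeOfLevel? (subsets-unique m)

    ∈-trees⁻ : ∀ {S} → S ∈ trees → TreeOfLevel S
    ∈-trees⁻ S∈ = proj₂ (∈-filter⁻ treeOfLevel? {xs = subsets m} S∈)

    ∈-trees⁺ : ∀ {S} → TreeOfLevel S → S ∈ trees
    ∈-trees⁺ {S} p = ∈-filter⁺ treeOfLevel? (∈-subsets S) p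

    T-coefficient : TCoeff G s ℓ (length trees)
    T-coefficient = list⇒HasSize trees-unique sound complete
      where
      sound : ∀ {S} → S ∈ trees → Arborescence G s S × ExtActivity G S ℓ
      sound {S} S∈ = let t , eq = ∈-trees⁻ S∈ in
        tree⇒arborescence S t , subst (ExtActivity G S) eq (activity S t)
      complete : ∀ {S} → Arborescence G s S × ExtActivity G S ℓ → S ∈ trees
      complete {S} (arb , act) = let t = arborescence⇒tree S arb in
        ∈-trees⁺ (t , HasSize-unique (activity S t) act)

    B-coefficient : BCoeff G s ℓ (length trees)
    B-coefficient = (λ i → decode (tree i)) , sound , distinct , onto
      where
      tree : Fin (length trees) → Subset m
      tree = lookupₗ trees
      isTree : ∀ i → TreeOfLevel (tree i)
      isTree i = ∈-trees⁻ (∈-lookup i)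
      sound : ∀ i → Recurrent G s (decode (tree i)) × ClassLevel G s (decode (tree i)) ℓ
      sound i = let t , eq = isTree i in
        decode-recurrent t , subst (ClassLevel G s (decode (tree i))) eq (decode-level t)
      distinct : ∀ i j → _∼_ G s (decode (tree i)) (decode (tree j)) → i ≡ j
      distinct i j i∼j = let t , _ = isTree i ; t′ , _ = isTree j ; st = decode-stable t in
        lookup-injective trees-unique i j
          (trans (sym (encode-decode t st refl)) (encode-decode t′ st (decode-∼⇒≡ t i∼j)))
      onto : ∀ c → Recurrent G s c × ClassLevel G s c ℓ → ∃ λ i → _∼_ G s (decode (tree i)) c
      onto c (rec , lvl) with recurrent⇒decode rec
      ... | S , t , refl = let S∈ = ∈-trees⁺ (t , decode-level-unique t lvl) in
        index S∈ , subst (λ U → _∼_ G s (decode U) (decode S)) (lookup-index S∈) (decode-∼ t)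

theorem1p2 : (G : Digraph) (s : Fin (Digraph.n G)) →
    Connected G → Eulerian G →
    ∀ ℓ → ∃ λ N → BCoeff G s ℓ N × TCoeff G s ℓ N
theorem1p2 G s _ eulerian ℓ = length (trees ℓ) , B-coefficient ℓ , T-coefficient ℓ
  where open Correspondence G s eulerian
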